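{- Let $t, r, s$ be integers with $1 \leq t \leq r \leq s$, and let \[c(r,s,t) = r + (s-t)\max \left\{2{s \choose t}, \; 2^r(r-t){r \choose t} + 1 \right\}.\] If $\mathcal{H}$ is a hereditary family with $\mu(\mathcal{H}) \geq c(r,s,t)$, then \[m(\mathcal{H}^{(r)},\mathcal{H}^{(s)},t) = |\mathcal{H}^{(r)}(I)| + |\{B \in \mathcal{H}^{(s)} \colon |B \cap I| \geq t\}|\] for some set $I \in \mathcal{H}$ with $t \leq |I| \leq r$.
   Context: All sets and families (sets of sets) are finite. A family $\mathcal{H}$ is hereditary if for every $A \in \mathcal{H}$, every subset of $A$ is in $\mathcal{H}$. For a family $\mathcal{F}$, $\mathcal{F}^{(r)}$ denotes the family of $r$-element sets in $\mathcal{F}$. A set $B \in \mathcal{F}$ is a base of $\mathcal{F}$ if $B$ is not a proper subset of any $A \in \mathcal{F}$; $\mu(\mathcal{F})$ is the size of a smallest base of $\mathcal{F}$. For a family $\mathcal{F}$ and a set $T$, $\mathcal{F}(T) = \{A \in \mathcal{F} \colon T \subseteq A\}$. Families $\mathcal{A}, \mathcal{B}$ are cross-$t$-intersecting if $|A \cap B| \geq t$ for all $A \in \mathcal{A}$, $B \in \mathcal{B}$. For families $\mathcal{F}, \mathcal{G}$, $m(\mathcal{F},\mathcal{G},t)$ is the maximum of $|\mathcal{A}|+|\mathcal{B}|$ over all pairs with $\emptyset \neq \mathcal{A} \subseteq \mathcal{F}$, $\emptyset \neq \mathcal{B} \subseteq \mathcal{G}$, $\mathcal{A}$ and $\mathcal{B}$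 cross-$t$-intersecting. -}

module Defs where

open import Data.Bool.Base using (Bool; true; false; _∧_; if_then_else_)
open import Data.Nat.Base using (ℕ; zero; suc; _≤_; _<_; _≤ᵇ_; _≡ᵇ_; _∸_; _+_; _*_; _^_; _⊔_)
open import Data.Nat.Combinatorics using (_C_)
open import Data.Fin.Subset using (Subset; _⊆_; _⊂_; _∩_; ∣_∣; inside; outside)
open import Data.Fin.Subset.Properties using (_⊆?_)
open import Data.List.Base using (List; []; _∷_; _++_; map; length; filterᵇ)
open import Data.Vec.Base using (_∷_; [])
open import Data.Product.Base using (_×_; ∃; Σ)
open import Relation.Nullary using (¬_; does)
open import Relation.Binary.PropositionalEquality using (_≡_)

-- Ground set: Fin n.  A "set" is a Subset n; a family is given by its
-- (Boolean) characteristic function on Subset n (hence finite).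
Family : ℕ → Set
Family n = Subset n → Bool

allSubsets : (n : ℕ) → List (Subset n)
allSubsets zero = [] ∷ []
allSubsets (suc n) = map (inside ∷_) (allSubsets n) ++ map (outside ∷_) (allSubsets n)

card : {n : ℕ} → Family n → ℕ
card {n} F = length (filterᵇ F (allSubsets n))

_∈F_ : {n : ℕ} → Subset n → Family n → Set
A ∈F F = F A ≡ true

_⊑_ : {n : ℕ} → Family n → Family n → Set
𝒜 ⊑ ℱ = ∀ A → A ∈F 𝒜 → A ∈F ℱ

NonEmpty : {n : ℕ} → Family n → Set
NonEmpty F = ∃ λ A → A ∈F F

Hereditary : {n : ℕ} → Family n → Set
Hereditary H = ∀ A B → A ∈F H → B ⊆ A → B ∈F H

IsBase : {n : ℕ} → Family n → Subset n → Set
IsBase F B = B ∈F F × (∀ A → A ∈F F → ¬ (B ⊂ A))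

-- μ(F) ≥ k : μ(F) (the least size of a base) is defined, i.e. F is nonempty,
-- and every base of F has at least k elements.
μ≥ : {n : ℕ} → Family n → ℕ → Set
μ≥ F k = NonEmpty F × (∀ B → IsBase F B → k ≤ ∣ B ∣)

level : {n : ℕ} → Family n → ℕ → Family n
level F r A = F A ∧ (∣ A ∣ ≡ᵇ r)

containing : {n : ℕ} → Family n → Subset n → Family n
containing F T A = F A ∧ does (T ⊆? A)

meetingIn : {n : ℕ} → Family n → Subset n → ℕ → Family n
meetingIn F I t B = F B ∧ (t ≤ᵇ ∣ B ∩ I ∣)

CrossIntersecting : {n : ℕ} → Family n → Family n → ℕ → Set
CrossIntersecting 𝒜 ℬ t = ∀ A B → A ∈F 𝒜 → B ∈F ℬ → t ≤ ∣ A ∩ B ∣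

Admissible : {n : ℕ} → Family n → Family n → ℕ → Family n → Family n → Set
Admissible F G t 𝒜 ℬ =
  NonEmpty 𝒜 × NonEmpty ℬ × 𝒜 ⊑ F × ℬ ⊑ G × CrossIntersecting 𝒜 ℬ t

m≡ : {n : ℕ} → Family n → Family n → ℕ → ℕ → Set
m≡ F G t k =
  (Σ (Family _) λ 𝒜 → Σ (Family _) λ ℬ → Admissible F G t 𝒜 ℬ × card 𝒜 + card ℬ ≡ k)
  × (∀ 𝒜 ℬ → Admissible F G t 𝒜 ℬ → card 𝒜 + card ℬ ≤ k)

c : ℕ → ℕ → ℕ → ℕ
c r s t = r + (s ∸ t) * ((2 * (s C t)) ⊔ (2 ^ r * (r ∸ t) * (r C t) + 1))

{-# OPTIONS --safe #-}

-- Write N k S for the number of k-sets of H that contain S, and c r s t = r + (s - t) M.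
-- Double counting gives M * N k (S ∪ {x}) ≤ N k S whenever t ≤ ∣S∣ ≤ r and k ≤ s, so if
-- ∣S ∩ A∣ < t, then only few of the k-sets containing S meet A in at least t elements.
-- Let I be the intersection of 𝒜, let A₀ ∈ 𝒜, and let K be the largest of the sums
-- attached to the sets I ∈ H with t ≤ ∣I∣ ≤ r.
-- If t ≤ ∣I∣, then either every B ∈ ℬ meets I in t elements and the pair is dominated by the
-- sum of I, or 2∣𝒜∣ ≤ N r I, while at most half of the s-sets meeting A₀ but not I in
-- t elements lie in ℬ; hence ∣𝒜∣ + ∣ℬ∣ is at most the average of the sums of I and A₀.
-- If ∣I∣ < t, then every t-subset of A₀ is missed by some A ∈ 𝒜, so 2∣ℬ∣ ≤ K.  For r < s also
-- 2∣𝒜∣ ≤ K, because M * N r S ≤ N s S for t-sets S; for r = s exchange 𝒜 and ℬ.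
module Submission where

open import Defs
open import Data.Bool.Base using (Bool; true; false; _∧_; not)
import Data.Bool.Properties as Bool
open import Data.Nat.Base
open import Data.Nat.Properties
open import Data.Nat.Combinatorics using (_C_; nCk+nC[k+1]≡[n+1]C[k+1]; nCn≡1)
open import Data.Nat.Solver using (module +-*-Solver)
open import Data.Fin.Base using (Fin; zero; suc)
import Data.Fin.Properties as Fin
open import Data.Fin.Subset using (Subset; ∣_∣; _∈_; _∉_; _⊆_; _⊈_; _∩_; _─_; ⊥; ⊤; inside; outside)
open import Data.Fin.Subset.Properties
open import Data.List.Base using (List; []; _∷_; _++_; map; length; filter; filterᵇ; allFin; tabulate)
open import Data.List.Extrema.Nat using (argmax; argmax-all; f[xs]≤f[argmax])
import Data.List.Relation.Unary.All as All
open import Data.List.Relation.Unary.All.Properties using (all-filter)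
open import Data.List.Relation.Unary.Any using (here; there)
open import Data.List.Membership.Propositional using () renaming (_∈_ to _∈ᴸ_)
open import Data.List.Membership.Propositional.Properties using (∈-++⁺ˡ; ∈-++⁺ʳ; ∈-map⁺; ∈-allFin; ∈-filter⁺)
open import Data.Vec.Base using ([]; _∷_; here; there; lookup; updateAt)
open import Data.Vec.Properties using ([]=⇒lookup; lookup⇒[]=; updateAt-minimal)
open import Data.Product.Base using (_×_; _,_; proj₁; proj₂; ∃)
open import Data.Sum.Base using (_⊎_; inj₁; inj₂; [_,_]′)
open import Data.Empty using (⊥-elim)
open import Function.Base using (_∘_; id; case_of_)
open import Relation.Nullary using (¬_; Dec; yes; no; does; contradiction; ¬?)
open import Relation.Nullary.Decidable using (dec-true; _×-dec_)
open import Relation.Binary.PropositionalEquality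

private
  variable
    X Y : Set
    n : ℕ

-- Finite sums over lists

∑ : List X → (X → ℕ) → ℕ
∑ []       f = 0
∑ (x ∷ xs) f = f x + ∑ xs f

∑-mono : ∀ (xs : List X) {f g} → (∀ x → f x ≤ g x) → ∑ xs f ≤ ∑ xs g
∑-mono []       f≤g = z≤n
∑-mono (x ∷ xs) f≤g = +-mono-≤ (f≤g x) (∑-mono xs f≤g)

∑-cong : ∀ (xs : List X) {f g} → (∀ x → f x ≡ g x) → ∑ xs f ≡ ∑ xs g
∑-cong []       f≡g = refl
∑-cong (x ∷ xs) f≡g = cong₂ _+_ (f≡g x) (∑-cong xs f≡g)

∑-+ : ∀ (xs : List X) f g → ∑ xs (λ x → f x + g x) ≡ ∑ xs f + ∑ xs g
∑-+ []       f g = refl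
∑-+ (x ∷ xs) f g = begin
  f x + g x + ∑ xs (λ y → f y + g y)  ≡⟨ cong (f x + g x +_) (∑-+ xs f g) ⟩
  f x + g x + (∑ xs f + ∑ xs g)       ≡⟨ +-assoc (f x) (g x) _ ⟩
  f x + (g x + (∑ xs f + ∑ xs g))     ≡⟨ cong (f x +_) (x+[y+z]≡y+[x+z] (g x) (∑ xs f) (∑ xs g)) ⟩
  f x + (∑ xs f + (g x + ∑ xs g))     ≡⟨ +-assoc (f x) _ _ ⟨
  f x + ∑ xs f + (g x + ∑ xs g)       ∎
  where
  open ≡-Reasoning
  x+[y+z]≡y+[x+z] : ∀ x y z → x + (y + z) ≡ y + (x + z)
  x+[y+z]≡y+[x+z] x y z = trans (sym (+-assoc x y z)) (trans (cong (_+ z) (+-comm x y)) (+-assoc y x z))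

∑-*ˡ : ∀ (xs : List X) k f → ∑ xs (λ x → k * f x) ≡ k * ∑ xs f
∑-*ˡ []       k f = sym (*-zeroʳ k)
∑-*ˡ (x ∷ xs) k f = trans (cong (k * f x +_) (∑-*ˡ xs k f)) (sym (*-distribˡ-+ k (f x) (∑ xs f)))

∑-*ʳ : ∀ (xs : List X) f k → ∑ xs (λ x → f x * k) ≡ ∑ xs f * k
∑-*ʳ []       f k = refl
∑-*ʳ (x ∷ xs) f k = trans (cong (f x * k +_) (∑-*ʳ xs f k)) (sym (*-distribʳ-+ k (f x) (∑ xs f)))

∑-zero : ∀ (xs : List X) → ∑ xs (λ _ → 0) ≡ 0
∑-zero []       = refl
∑-zero (_ ∷ xs) = ∑-zero xs

∑-swap : ∀ (xs : List X) (ys : List Y) (f : X → Y → ℕ) → ∑ xs (λ x → ∑ ys (f x)) ≡ ∑ ys (λ y → ∑ xs (λ x → f x y))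
∑-swap []       ys f = sym (∑-zero ys)
∑-swap (x ∷ xs) ys f = trans (cong (∑ ys (f x) +_) (∑-swap xs ys f)) (sym (∑-+ ys (f x) _))

∑-++ : ∀ (xs ys : List X) f → ∑ (xs ++ ys) f ≡ ∑ xs f + ∑ ys f
∑-++ []       ys f = refl
∑-++ (x ∷ xs) ys f = trans (cong (f x +_) (∑-++ xs ys f)) (sym (+-assoc (f x) _ _))

∑-map : ∀ (g : X → Y) xs f → ∑ (map g xs) f ≡ ∑ xs (f ∘ g)
∑-map g []       f = refl
∑-map g (x ∷ xs) f = cong (f (g x) +_) (∑-map g xs f)

∑-∈ : ∀ {x} {xs : List X} f → x ∈ᴸ xs → f x ≤ ∑ xs f
∑-∈ f (here refl)          = m≤m+n _ _
∑-∈ f (there {x = y} x∈xs) = ≤-trans (∑-∈ f x∈xs) (m≤n+m _ (f y))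

-- Indicators and Boolean reasoning

⟦_⟧ : Bool → ℕ
⟦ true  ⟧ = 1
⟦ false ⟧ = 0

⟦⟧-≤ : ∀ b {k} → (b ≡ true → 1 ≤ k) → ⟦ b ⟧ ≤ k
⟦⟧-≤ true  h = h refl
⟦⟧-≤ false h = z≤n

⟦⟧-true : ∀ {b} → b ≡ true → 1 ≤ ⟦ b ⟧
⟦⟧-true refl = ≤-refl

⟦⟧-mono : ∀ b c → (b ≡ true → c ≡ true) → ⟦ b ⟧ ≤ ⟦ c ⟧
⟦⟧-mono b c b⇒c = ⟦⟧-≤ b (⟦⟧-true ∘ b⇒c)

∧⁺ : ∀ {b c} → b ≡ true → c ≡ true → b ∧ c ≡ true
∧⁺ refl refl = refl

∧⁻ : ∀ b {c} → b ∧ c ≡ true → b ≡ true × c ≡ true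
∧⁻ true e = refl , e

not⁺ : ∀ {b} → ¬ (b ≡ true) → not b ≡ true
not⁺ {true}  h = contradiction refl h
not⁺ {false} h = refl

not⁻ : ∀ {b} → not b ≡ true → b ≡ false
not⁻ {false} h = refl

does⁻ : ∀ {P : Set} (P? : Dec P) → does P? ≡ true → P
does⁻ (yes p) _ = p

-- Sums over all subsets of the ground set

∑ˢ : (Subset n → ℕ) → ℕ
∑ˢ = ∑ (allSubsets _)

∈-allSubsets : (A : Subset n) → A ∈ᴸ allSubsets n
∈-allSubsets []            = here refl
∈-allSubsets (inside  ∷ A) = ∈-++⁺ˡ (∈-map⁺ (inside ∷_) (∈-allSubsets A))
∈-allSubsets (outside ∷ A) = ∈-++⁺ʳ (map (inside ∷_) (allSubsets _)) (∈-map⁺ (outside ∷_) (∈-allSubsets A))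

∑ˢ-suc : (f : Subset (suc n) → ℕ) → ∑ˢ f ≡ ∑ˢ (f ∘ (inside ∷_)) + ∑ˢ (f ∘ (outside ∷_))
∑ˢ-suc {n} f = trans (∑-++ (map (inside ∷_) (allSubsets n)) _ f)
  (cong₂ _+_ (∑-map (inside ∷_) (allSubsets n) f) (∑-map (outside ∷_) (allSubsets n) f))

card-∑ : (F : Family n) → card F ≡ ∑ˢ (⟦_⟧ ∘ F)
card-∑ F = go (allSubsets _)
  where
  go : ∀ xs → length (filterᵇ F xs) ≡ ∑ xs (⟦_⟧ ∘ F)
  go []       = refl
  go (A ∷ xs) with F A
  ... | true  = cong suc (go xs)
  ... | false = go xs

-- Symmetric difference with `{x}`: it adds `x` to the sets that avoid it and removes it from the
-- others. It permutes the subsets, so sums can be reindexed between `A` and `A ∪ {x}`.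
toggle : Fin n → Subset n → Subset n
toggle x A = updateAt A x not

∑ˢ-toggle : (x : Fin n) (f : Subset n → ℕ) → ∑ˢ (f ∘ toggle x) ≡ ∑ˢ f
∑ˢ-toggle zero    f = begin
  ∑ˢ (f ∘ toggle zero)                              ≡⟨ ∑ˢ-suc (f ∘ toggle zero) ⟩
  ∑ˢ (f ∘ (outside ∷_)) + ∑ˢ (f ∘ (inside ∷_))      ≡⟨ +-comm (∑ˢ (f ∘ (outside ∷_))) _ ⟩
  ∑ˢ (f ∘ (inside ∷_)) + ∑ˢ (f ∘ (outside ∷_))      ≡⟨ ∑ˢ-suc f ⟨
  ∑ˢ f                                              ∎
  where open ≡-Reasoning
∑ˢ-toggle (suc x) f = begin
  ∑ˢ (f ∘ toggle (suc x))                           ≡⟨ ∑ˢ-suc (f ∘ toggle (suc x)) ⟩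
  ∑ˢ (f ∘ (inside ∷_) ∘ toggle x) + ∑ˢ (f ∘ (outside ∷_) ∘ toggle x)
    ≡⟨ cong₂ _+_ (∑ˢ-toggle x (f ∘ (inside ∷_))) (∑ˢ-toggle x (f ∘ (outside ∷_))) ⟩
  ∑ˢ (f ∘ (inside ∷_)) + ∑ˢ (f ∘ (outside ∷_))      ≡⟨ ∑ˢ-suc f ⟨
  ∑ˢ f                                              ∎
  where open ≡-Reasoning

-- Cardinalities of families

card-mono : {F G : Family n} → F ⊑ G → card F ≤ card G
card-mono {F = F} {G} F⊑G rewrite card-∑ F | card-∑ G = ∑-mono (allSubsets _) λ A → ⟦⟧-mono (F A) (G A) (F⊑G A)

card-⊎ : {F G K : Family n} → (∀ A → A ∈F F → A ∈F G ⊎ A ∈F K) → card F ≤ card G + card K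
card-⊎ {F = F} {G} {K} h rewrite card-∑ F | card-∑ G | card-∑ K | sym (∑-+ (allSubsets _) (⟦_⟧ ∘ G) (⟦_⟧ ∘ K)) =
  ∑-mono (allSubsets _) λ A → ⟦⟧-≤ (F A) λ A∈F →
    [ (λ A∈G → ≤-trans (⟦⟧-true A∈G) (m≤m+n _ _)) , (λ A∈K → ≤-trans (⟦⟧-true A∈K) (m≤n+m _ ⟦ G A ⟧)) ]′ (h A A∈F)

card-disjoint : {F G K : Family n} → G ⊑ F → K ⊑ F → (∀ A → A ∈F G → ¬ (A ∈F K)) → card G + card K ≤ card F
card-disjoint {F = F} {G} {K} G⊑F K⊑F disj rewrite card-∑ F | card-∑ G | card-∑ K | sym (∑-+ (allSubsets _) (⟦_⟧ ∘ G) (⟦_⟧ ∘ K)) =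
  ∑-mono (allSubsets _) pointwise
  where
  pointwise : ∀ A → ⟦ G A ⟧ + ⟦ K A ⟧ ≤ ⟦ F A ⟧
  pointwise A with G A in A∈G | K A in A∈K
  ... | true  | true  = contradiction A∈K (disj A A∈G)
  ... | true  | false = ⟦⟧-true (G⊑F A A∈G)
  ... | false | true  = ⟦⟧-true (K⊑F A A∈K)
  ... | false | false = z≤n

card-empty : {F : Family n} → (∀ A → ¬ (A ∈F F)) → card F ≡ 0
card-empty {n} {F} none = n≤0⇒n≡0 (begin
  card F                 ≡⟨ card-∑ F ⟩
  ∑ˢ (⟦_⟧ ∘ F)           ≤⟨ ∑-mono (allSubsets n) (λ A → ⟦⟧-≤ (F A) (λ A∈F → contradiction A∈F (none A))) ⟩
  ∑ˢ {n} (λ _ → 0)       ≡⟨ ∑-zero (allSubsets n) ⟩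
  0                      ∎)
  where open ≤-Reasoning

-- Double counting of the pairs `(x , A)` with `p x` and `A ∈F G x`; every member of `F` occurs in
-- at least one pair. The factor `M` replaces a division of `w`.
union-bound : (F : Family n) (xs : List X) (p : X → Bool) (G : X → Family n) (M w : ℕ) →
  (∀ A → A ∈F F → ∃ λ x → x ∈ᴸ xs × p x ≡ true × A ∈F G x) →
  (∀ x → p x ≡ true → M * card (G x) ≤ w) →
  M * card F ≤ ∑ xs (⟦_⟧ ∘ p) * w
union-bound {n} F xs p G M w covers bound = begin
  M * card F                                                  ≡⟨ cong (M *_) (card-∑ F) ⟩
  M * ∑ˢ (⟦_⟧ ∘ F)                                            ≤⟨ *-monoʳ-≤ M (∑-mono (allSubsets _) pointwise) ⟩
  M * ∑ˢ (λ A → ∑ xs (λ x → ⟦ p x ⟧ * ⟦ G x A ⟧))             ≡⟨ cong (M *_) (∑-swap (allSubsets n) xs _) ⟩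
  M * ∑ xs (λ x → ∑ˢ (λ A → ⟦ p x ⟧ * ⟦ G x A ⟧))             ≡⟨ ∑-*ˡ xs M _ ⟨
  ∑ xs (λ x → M * ∑ˢ (λ A → ⟦ p x ⟧ * ⟦ G x A ⟧))             ≤⟨ ∑-mono xs termwise ⟩
  ∑ xs (λ x → ⟦ p x ⟧ * w)                                    ≡⟨ ∑-*ʳ xs (⟦_⟧ ∘ p) w ⟩
  ∑ xs (⟦_⟧ ∘ p) * w                                          ∎
  where
  open ≤-Reasoning
  pointwise : ∀ A → ⟦ F A ⟧ ≤ ∑ xs (λ x → ⟦ p x ⟧ * ⟦ G x A ⟧)
  pointwise A = ⟦⟧-≤ (F A) λ A∈F → let x , x∈xs , px , A∈G = covers A A∈F in
    ≤-trans (*-mono-≤ (⟦⟧-true px) (⟦⟧-true A∈G)) (∑-∈ (λ x → ⟦ p x ⟧ * ⟦ G x A ⟧) x∈xs)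
  termwise : ∀ x → M * ∑ˢ (λ A → ⟦ p x ⟧ * ⟦ G x A ⟧) ≤ ⟦ p x ⟧ * w
  termwise x rewrite ∑-*ˡ (allSubsets _) ⟦ p x ⟧ (⟦_⟧ ∘ G x) | sym (card-∑ (G x)) with p x in px
  ... | true  rewrite +-identityʳ (card (G x)) | +-identityʳ w = bound x px
  ... | false rewrite *-zeroʳ M = z≤n

-- Sizes of sets

∣∷∣ : ∀ b (A : Subset n) → ∣ b ∷ A ∣ ≡ ⟦ b ⟧ + ∣ A ∣
∣∷∣ true  A = refl
∣∷∣ false A = refl

∑-allFin-suc : (f : Fin (suc n) → ℕ) → ∑ (allFin (suc n)) f ≡ f zero + ∑ (allFin n) (f ∘ suc)
∑-allFin-suc f = cong (f zero +_) (go id)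
  where
  go : ∀ {m} (g : Fin m → Fin _) → ∑ (tabulate (suc ∘ g)) f ≡ ∑ (tabulate g) (f ∘ suc)
  go {zero}  g = refl
  go {suc m} g = cong (f (suc (g zero)) +_) (go (g ∘ suc))

∣∣-∑ : (A : Subset n) → ∣ A ∣ ≡ ∑ (allFin n) (⟦_⟧ ∘ lookup A)
∣∣-∑ []      = refl
∣∣-∑ (b ∷ A) = trans (∣∷∣ b A) (trans (cong (⟦ b ⟧ +_) (∣∣-∑ A)) (sym (∑-allFin-suc (⟦_⟧ ∘ lookup (b ∷ A)))))

∣∣-split : (A B : Subset n) → ∣ A ∩ B ∣ + ∣ A ─ B ∣ ≡ ∣ A ∣
∣∣-split []            []            = refl
∣∣-split (outside ∷ A) (outside ∷ B) = ∣∣-split A B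
∣∣-split (outside ∷ A) (inside ∷ B)  = ∣∣-split A B
∣∣-split (inside ∷ A)  (outside ∷ B) = trans (+-suc _ _) (cong suc (∣∣-split A B))
∣∣-split (inside ∷ A)  (inside ∷ B)  = cong suc (∣∣-split A B)

∣∩∣-comm : (A B : Subset n) → ∣ A ∩ B ∣ ≡ ∣ B ∩ A ∣
∣∩∣-comm A B = cong ∣_∣ (∩-comm A B)

∩-monoʳ : ∀ {A B} (D : Subset n) → A ⊆ B → ∣ D ∩ A ∣ ≤ ∣ D ∩ B ∣
∩-monoʳ {A = A} D A⊆B = p⊆q⇒∣p∣≤∣q∣ λ x∈ → let x∈D , x∈A = x∈p∩q⁻ D A x∈ in x∈p∩q⁺ (x∈D , A⊆B x∈A)

⊆⇒∣∣≤∣∩∣ : ∀ {A B D : Subset n} → A ⊆ B → A ⊆ D → ∣ A ∣ ≤ ∣ B ∩ D ∣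
⊆⇒∣∣≤∣∩∣ A⊆B A⊆D = p⊆q⇒∣p∣≤∣q∣ λ x∈A → x∈p∩q⁺ (A⊆B x∈A , A⊆D x∈A)

⊈⇒∃ : ∀ {A B : Subset n} → A ⊈ B → ∃ λ x → x ∈ A × x ∉ B
⊈⇒∃ {A = []}          {[]}          A⊈B = contradiction (λ ()) A⊈B
⊈⇒∃ {A = outside ∷ A} {b ∷ B}       A⊈B =
  let x , x∈A , x∉B = ⊈⇒∃ (A⊈B ∘ out⊆) in suc x , there x∈A , x∉B ∘ drop-there
⊈⇒∃ {A = inside ∷ A}  {inside ∷ B}  A⊈B =
  let x , x∈A , x∉B = ⊈⇒∃ (A⊈B ∘ in⊆in) in suc x , there x∈A , x∉B ∘ drop-there
⊈⇒∃ {A = inside ∷ A}  {outside ∷ B} A⊈B = zero , here , λ ()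

⊈⇒∣∩∣< : ∀ {A B : Subset n} → A ⊈ B → ∣ A ∩ B ∣ < ∣ A ∣
⊈⇒∣∩∣< {A = A} {B} A⊈B = let x , x∈A , x∉B = ⊈⇒∃ A⊈B in
  p⊂q⇒∣p∣<∣q∣ (p∩q⊆p A B , x , x∈A , x∉B ∘ p∩q⊆q A B)

interpolate : ∀ {A B : Subset n} k → A ⊆ B → ∣ A ∣ ≤ k → k ≤ ∣ B ∣ → ∃ λ W → A ⊆ W × W ⊆ B × ∣ W ∣ ≡ k
interpolate {A = []} {[]} zero A⊆B _ _ = [] , id , id , refl
interpolate {A = outside ∷ A} {outside ∷ B} k A⊆B lo hi =
  let W , A⊆W , W⊆B , e = interpolate k (drop-∷-⊆ A⊆B) lo hi in outside ∷ W , out⊆ A⊆W , out⊆ W⊆B , e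
interpolate {A = inside ∷ A} {outside ∷ B} k A⊆B lo hi = case A⊆B here of λ ()
interpolate {A = inside ∷ A} {inside ∷ B} (suc k) A⊆B (s≤s lo) (s≤s hi) =
  let W , A⊆W , W⊆B , e = interpolate k (drop-∷-⊆ A⊆B) lo hi in inside ∷ W , in⊆in A⊆W , in⊆in W⊆B , cong suc e
interpolate {A = outside ∷ A} {inside ∷ B} k A⊆B lo hi with k ≤? ∣ B ∣
... | yes k≤ = let W , A⊆W , W⊆B , e = interpolate k (drop-∷-⊆ A⊆B) lo k≤ in outside ∷ W , out⊆ A⊆W , out⊆ W⊆B , e
-- Here `k` exceeds `∣ B ∣` but not `suc ∣ B ∣`, so only the whole set `inside ∷ B` has the right
-- size.
... | no k≰ = inside ∷ B , out⊆ (drop-∷-⊆ A⊆B) , id , ≤-antisym (≰⇒> k≰) hi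

kSubset : ∀ (B : Subset n) k → k ≤ ∣ B ∣ → ∃ λ W → W ⊆ B × ∣ W ∣ ≡ k
kSubset {n} B k k≤ = let W , _ , W⊆B , e = interpolate k (⊆-min B) (≤-trans (≤-reflexive (∣⊥∣≡0 n)) z≤n) k≤ in W , W⊆B , e

subsetsOf : Subset n → ℕ → Family n
subsetsOf A k W = does (W ⊆? A) ∧ (∣ W ∣ ≡ᵇ k)

-- Pascal's rule, splitting the subsets by whether they contain the first point.
∑-subsetsOf : (A : Subset n) (k : ℕ) → ∑ˢ (⟦_⟧ ∘ subsetsOf A k) ≡ ∣ A ∣ C k
∑-subsetsOf []            zero    = refl
∑-subsetsOf []            (suc k) = refl
∑-subsetsOf {suc n} (outside ∷ A) k = trans (∑ˢ-suc (⟦_⟧ ∘ subsetsOf (outside ∷ A) k))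
  (cong₂ _+_ (∑-zero (allSubsets n)) (∑-subsetsOf A k))
∑-subsetsOf {suc n} (inside ∷ A) zero = trans (∑ˢ-suc (⟦_⟧ ∘ subsetsOf (inside ∷ A) zero))
  (cong₂ _+_ (trans (∑-cong (allSubsets n) (λ W → cong ⟦_⟧ (Bool.∧-zeroʳ (does (W ⊆? A))))) (∑-zero (allSubsets n)))
    (∑-subsetsOf A zero))
∑-subsetsOf {suc n} (inside ∷ A) (suc k) = trans (∑ˢ-suc (⟦_⟧ ∘ subsetsOf (inside ∷ A) (suc k)))
  (trans (cong₂ _+_ (∑-subsetsOf A k) (∑-subsetsOf A (suc k))) (nCk+nC[k+1]≡[n+1]C[k+1] ∣ A ∣ k))

-- Adding and removing one point

lookup⁺ : ∀ {A : Subset n} {x} → x ∈ A → lookup A x ≡ true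
lookup⁺ = []=⇒lookup

lookup⁻ : ∀ {A : Subset n} {x} → lookup A x ≡ true → x ∈ A
lookup⁻ {A = A} {x} = lookup⇒[]= x A

∉⇒lookup : ∀ {A : Subset n} {x} → x ∉ A → not (lookup A x) ≡ true
∉⇒lookup x∉A = not⁺ (x∉A ∘ lookup⁻)

lookup⇒∉ : ∀ {A : Subset n} {x} → not (lookup A x) ≡ true → x ∉ A
lookup⇒∉ e x∈A rewrite lookup⁺ x∈A = case e of λ ()

∈-toggle : ∀ {A : Subset n} {x y} → y ≢ x → y ∈ A → y ∈ toggle x A
∈-toggle {A = A} {x} {y} y≢x = updateAt-minimal y x A y≢x

∈-toggle⁻ : ∀ {A : Subset n} {x y} → y ≢ x → y ∈ toggle x A → y ∈ A
∈-toggle⁻ {A = b ∷ A} {zero}  {zero}  y≢x _ = contradiction refl y≢x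
∈-toggle⁻ {A = b ∷ A} {zero}  {suc y} y≢x (there y∈) = there y∈
∈-toggle⁻ {A = b ∷ A} {suc x} {zero}  y≢x here = here
∈-toggle⁻ {A = b ∷ A} {suc x} {suc y} y≢x (there y∈) = there (∈-toggle⁻ (y≢x ∘ cong suc) y∈)

∉⇒∈-toggle : ∀ {A : Subset n} {x} → x ∉ A → x ∈ toggle x A
∉⇒∈-toggle {A = inside ∷ A}  {zero}  x∉A = contradiction here x∉A
∉⇒∈-toggle {A = outside ∷ A} {zero}  x∉A = here
∉⇒∈-toggle {A = b ∷ A}       {suc x} x∉A = there (∉⇒∈-toggle (x∉A ∘ there))

∈⇒∉-toggle : ∀ {A : Subset n} {x} → x ∈ A → x ∉ toggle x A
∈⇒∉-toggle (here)      ()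
∈⇒∉-toggle (there x∈A) (there x∈) = ∈⇒∉-toggle x∈A x∈

∣toggle∣-∉ : ∀ {A : Subset n} {x} → x ∉ A → ∣ toggle x A ∣ ≡ suc ∣ A ∣
∣toggle∣-∉ {A = inside ∷ A}  {zero}  x∉A = contradiction here x∉A
∣toggle∣-∉ {A = outside ∷ A} {zero}  x∉A = refl
∣toggle∣-∉ {A = inside ∷ A}  {suc x} x∉A = cong suc (∣toggle∣-∉ (x∉A ∘ there))
∣toggle∣-∉ {A = outside ∷ A} {suc x} x∉A = ∣toggle∣-∉ (x∉A ∘ there)

∣toggle∣-∈ : ∀ {A : Subset n} {x} → x ∈ A → suc ∣ toggle x A ∣ ≡ ∣ A ∣
∣toggle∣-∈ {A = inside ∷ A}  here        = refl
∣toggle∣-∈ {A = inside ∷ A}  (there x∈A) = cong suc (∣toggle∣-∈ x∈A)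
∣toggle∣-∈ {A = outside ∷ A} (there x∈A) = ∣toggle∣-∈ x∈A

⊆-toggle : ∀ {A : Subset n} {x} → x ∉ A → A ⊆ toggle x A
⊆-toggle {x = x} x∉A {y} y∈A = ∈-toggle (λ { refl → x∉A y∈A }) y∈A

toggle-⊆ : ∀ {A : Subset n} {x} → x ∈ A → toggle x A ⊆ A
toggle-⊆ {x = x} x∈A {y} y∈ with y Fin.≟ x
... | yes refl = x∈A
... | no y≢x   = ∈-toggle⁻ y≢x y∈

insert-⊆ : ∀ {A B : Subset n} {x} → A ⊆ B → x ∈ B → toggle x A ⊆ B
insert-⊆ {x = x} A⊆B x∈B {y} y∈ with y Fin.≟ x
... | yes refl = x∈B
... | no y≢x   = A⊆B (∈-toggle⁻ y≢x y∈)

-- Membership in levels, stars and meeting families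

≡ᵇ⁺ : ∀ {i k} → i ≡ k → (i ≡ᵇ k) ≡ true
≡ᵇ⁺ {i} {k} = dec-true (i ≟ k)

≡ᵇ⁻ : ∀ i k → (i ≡ᵇ k) ≡ true → i ≡ k
≡ᵇ⁻ i k = does⁻ (i ≟ k)

≤ᵇ⁺ : ∀ {i k} → i ≤ k → (i ≤ᵇ k) ≡ true
≤ᵇ⁺ {i} {k} = dec-true (i ≤? k)

≤ᵇ⁻ : ∀ i k → (i ≤ᵇ k) ≡ true → i ≤ k
≤ᵇ⁻ i k = does⁻ (i ≤? k)

subsetsOf⁻ : ∀ (A : Subset n) k S → S ∈F subsetsOf A k → S ⊆ A × ∣ S ∣ ≡ k
subsetsOf⁻ A k S S∈ = let S⊆A , e = ∧⁻ (does (S ⊆? A)) S∈ in does⁻ (S ⊆? A) S⊆A , ≡ᵇ⁻ ∣ S ∣ k e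

module _ (F : Family n) where

  level⁺ : ∀ A {k} → A ∈F F → ∣ A ∣ ≡ k → A ∈F level F k
  level⁺ A A∈F e = ∧⁺ A∈F (≡ᵇ⁺ e)

  level⁻ : ∀ k A → A ∈F level F k → A ∈F F × ∣ A ∣ ≡ k
  level⁻ k A A∈ = let A∈F , e = ∧⁻ (F A) A∈ in A∈F , ≡ᵇ⁻ ∣ A ∣ k e

  containing⁺ : ∀ S A → A ∈F F → S ⊆ A → A ∈F containing F S
  containing⁺ S A A∈F S⊆A = ∧⁺ A∈F (dec-true (S ⊆? A) S⊆A)

  containing⁻ : ∀ S A → A ∈F containing F S → A ∈F F × S ⊆ A
  containing⁻ S A A∈ = let A∈F , e = ∧⁻ (F A) A∈ in A∈F , does⁻ (S ⊆? A) e

  meetingIn⁺ : ∀ I {t} B → B ∈F F → t ≤ ∣ B ∩ I ∣ → B ∈F meetingIn F I t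
  meetingIn⁺ I B B∈F t≤ = ∧⁺ B∈F (≤ᵇ⁺ t≤)

  meetingIn⁻ : ∀ I t B → B ∈F meetingIn F I t → B ∈F F × t ≤ ∣ B ∩ I ∣
  meetingIn⁻ I t B B∈ = let B∈F , e = ∧⁻ (F B) B∈ in B∈F , ≤ᵇ⁻ t ∣ B ∩ I ∣ e

missing : Family n → Subset n → ℕ → Family n
missing F I t B = F B ∧ not (t ≤ᵇ ∣ B ∩ I ∣)

module _ (F : Family n) where

  missing⁺ : ∀ I t B → B ∈F F → ¬ (t ≤ ∣ B ∩ I ∣) → B ∈F missing F I t
  missing⁺ I t B B∈F t≰ = ∧⁺ B∈F (not⁺ (t≰ ∘ ≤ᵇ⁻ t ∣ B ∩ I ∣))

  missing⁻ : ∀ I t B → B ∈F missing F I t → B ∈F F × ¬ (t ≤ ∣ B ∩ I ∣)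
  missing⁻ I t B B∈ = let B∈F , e = ∧⁻ (F B) B∈ in B∈F , λ t≤ → case trans (sym (≤ᵇ⁺ t≤)) (not⁻ e) of λ ()

  card≤meeting+missing : ∀ I t → card F ≤ card (meetingIn F I t) + card (missing F I t)
  card≤meeting+missing I t = card-⊎ λ A A∈F → case t ≤? ∣ A ∩ I ∣ of λ
    { (yes t≤) → inj₁ (meetingIn⁺ F I A A∈F t≤) ; (no t≰) → inj₂ (missing⁺ I t A A∈F t≰) }

-- Hereditary families with large bases

-- The size of the difference of `B` and `A`, written as a sum over points so that it can enter a
-- double count.
∑-difference : ∀ {A B : Subset n} → A ⊆ B →
  ∑ (allFin n) (λ x → ⟦ lookup B x ∧ not (lookup A x) ⟧) + ∣ A ∣ ≡ ∣ B ∣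
∑-difference {n} {A} {B} A⊆B = begin
  ∑ (allFin n) (λ x → ⟦ lookup B x ∧ not (lookup A x) ⟧) + ∣ A ∣
    ≡⟨ cong (∑ (allFin n) (λ x → ⟦ lookup B x ∧ not (lookup A x) ⟧) +_) (∣∣-∑ A) ⟩
  ∑ (allFin n) (λ x → ⟦ lookup B x ∧ not (lookup A x) ⟧) + ∑ (allFin n) (⟦_⟧ ∘ lookup A)
    ≡⟨ ∑-+ (allFin n) _ _ ⟨
  ∑ (allFin n) (λ x → ⟦ lookup B x ∧ not (lookup A x) ⟧ + ⟦ lookup A x ⟧)
    ≡⟨ ∑-cong (allFin n) pointwise ⟩
  ∑ (allFin n) (⟦_⟧ ∘ lookup B)
    ≡⟨ ∣∣-∑ B ⟨
  ∣ B ∣ ∎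
  where
  open ≡-Reasoning
  pointwise : ∀ x → ⟦ lookup B x ∧ not (lookup A x) ⟧ + ⟦ lookup A x ⟧ ≡ ⟦ lookup B x ⟧
  pointwise x with lookup A x in a | lookup B x in b
  ... | true  | true  = refl
  ... | true  | false = case trans (sym (lookup⁺ (A⊆B (lookup⁻ a)))) b of λ ()
  ... | false | true  = refl
  ... | false | false = refl

module _ (H : Family n) where

  base-above : ∀ {A} → A ∈F H → ∃ λ B → A ⊆ B × IsBase H B
  base-above {A} = go n A (m≤m+n n ∣ A ∣)
    where
    -- Each enlargement adds at least one point and no set exceeds `n` points, so `fuel` bounds the
    -- number of enlargements still possible.
    go : ∀ fuel A → n ≤ fuel + ∣ A ∣ → A ∈F H → ∃ λ B → A ⊆ B × IsBase H B
    go fuel A enough A∈H with anySubset? (λ B → (H B Bool.≟ true) ×-dec (A ⊂? B))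
    ... | no none = A , id , A∈H , λ B B∈H A⊂B → none (B , B∈H , A⊂B)
    go zero A enough A∈H | yes (B , B∈H , A⊂B) =
      contradiction (≤-trans (≤-trans (p⊂q⇒∣p∣<∣q∣ A⊂B) (∣p∣≤n B)) enough) (<-irrefl refl)
    go (suc fuel) A enough A∈H | yes (B , B∈H , A⊂B) =
      let E , B⊆E , E-base = go fuel B (≤-trans enough (≤-trans (≤-reflexive (sym (+-suc fuel ∣ A ∣))) (+-monoʳ-≤ fuel (p⊂q⇒∣p∣<∣q∣ A⊂B)))) B∈H
      in E , ⊆-trans (p⊂q⇒p⊆q A⊂B) B⊆E , E-base

module LargeBases {n : ℕ} (H : Family n) (her : Hereditary H) (μ : ℕ) (bases : ∀ B → IsBase H B → μ ≤ ∣ B ∣) where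

  N : ℕ → Subset n → ℕ
  N k S = card (containing (level H k) S)

  extend : ∀ {A k} → A ∈F H → ∣ A ∣ ≤ k → k ≤ μ → ∃ λ B → A ⊆ B × B ∈F H × ∣ B ∣ ≡ k
  extend {A} {k} A∈H lo k≤μ =
    let B , A⊆B , B-base = base-above H A∈H
        W , A⊆W , W⊆B , e = interpolate k A⊆B lo (≤-trans k≤μ (bases B B-base))
    in W , A⊆W , her B W (proj₁ B-base) W⊆B , e

  -- Take a base `B` above `A`: by heredity, each point of `B` outside `A` can be added to `A`
  -- within `H`, and `∣ B ∣` is at least `μ`.
  degree : ∀ {A} → A ∈F H → μ ∸ ∣ A ∣ ≤ ∑ (allFin n) (λ x → ⟦ not (lookup A x) ∧ H (toggle x A) ⟧)
  degree {A} A∈H with base-above H A∈H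
  ... | B , A⊆B , B-base = begin
    μ ∸ ∣ A ∣              ≤⟨ ∸-monoˡ-≤ ∣ A ∣ (bases B B-base) ⟩
    ∣ B ∣ ∸ ∣ A ∣          ≡⟨ cong (_∸ ∣ A ∣) (∑-difference A⊆B) ⟨
    (∑ (allFin n) (λ x → ⟦ lookup B x ∧ not (lookup A x) ⟧) + ∣ A ∣) ∸ ∣ A ∣
                           ≡⟨ m+n∸n≡m _ ∣ A ∣ ⟩
    ∑ (allFin n) (λ x → ⟦ lookup B x ∧ not (lookup A x) ⟧)
                           ≤⟨ ∑-mono (allFin n) (λ x → ⟦⟧-mono (lookup B x ∧ not (lookup A x)) _ (λ e →
                                let x∈B , x∉A = ∧⁻ (lookup B x) e in
                                ∧⁺ x∉A (her B (toggle x A) (proj₁ B-base) (insert-⊆ A⊆B (lookup⁻ x∈B))))) ⟩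
    ∑ (allFin n) (λ x → ⟦ not (lookup A x) ∧ H (toggle x A) ⟧) ∎
    where open ≤-Reasoning

  -- Count the pairs (A , A ∪ {x}) with S ⊆ A, ∣A∣ = k and A ∪ {x} ∈ H.
  N-lift : ∀ k S → (μ ∸ k) * N k S ≤ (suc k ∸ ∣ S ∣) * N (suc k) S
  N-lift k S = begin
    (μ ∸ k) * N k S                                 ≡⟨ cong ((μ ∸ k) *_) (card-∑ P) ⟩
    (μ ∸ k) * ∑ˢ (⟦_⟧ ∘ P)                          ≡⟨ ∑-*ˡ (allSubsets n) (μ ∸ k) (⟦_⟧ ∘ P) ⟨
    ∑ˢ (λ A → (μ ∸ k) * ⟦ P A ⟧)                    ≤⟨ ∑-mono (allSubsets n) above ⟩
    ∑ˢ (λ A → ∑ (allFin n) (λ x → f x A))           ≡⟨ ∑-swap (allSubsets n) (allFin n) (λ A x → f x A) ⟩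
    ∑ (allFin n) (λ x → ∑ˢ (f x))                   ≤⟨ ∑-mono (allFin n) (λ x → ∑-mono (allSubsets n) (f≤g x)) ⟩
    ∑ (allFin n) (λ x → ∑ˢ (g x ∘ toggle x))        ≡⟨ ∑-cong (allFin n) (λ x → ∑ˢ-toggle x (g x)) ⟩
    ∑ (allFin n) (λ x → ∑ˢ (g x))                   ≡⟨ ∑-swap (allFin n) (allSubsets n) g ⟩
    ∑ˢ (λ A → ∑ (allFin n) (λ x → g x A))           ≤⟨ ∑-mono (allSubsets n) below ⟩
    ∑ˢ (λ A → (suc k ∸ ∣ S ∣) * ⟦ Q A ⟧)            ≡⟨ ∑-*ˡ (allSubsets n) (suc k ∸ ∣ S ∣) (⟦_⟧ ∘ Q) ⟩
    (suc k ∸ ∣ S ∣) * ∑ˢ (⟦_⟧ ∘ Q)                  ≡⟨ cong ((suc k ∸ ∣ S ∣) *_) (card-∑ Q) ⟨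
    (suc k ∸ ∣ S ∣) * N (suc k) S                   ∎
    where
    open ≤-Reasoning
    P Q : Family n
    P = containing (level H k) S
    Q = containing (level H (suc k)) S
    -- `f` marks a pair by its smaller set, `g` by its larger one. A smaller set has at least
    -- `μ ∸ k` extensions by `degree`; in a larger set the removed point is any of the
    -- `suc k ∸ ∣ S ∣` points outside `S`.
    f g : Fin n → Subset n → ℕ
    f x A = ⟦ P A ∧ (not (lookup A x) ∧ H (toggle x A)) ⟧
    g x A = ⟦ Q A ∧ (lookup A x ∧ not (lookup S x)) ⟧
    above : ∀ A → (μ ∸ k) * ⟦ P A ⟧ ≤ ∑ (allFin n) (λ x → f x A)
    above A with P A in A∈P
    ... | false rewrite *-zeroʳ (μ ∸ k) = z≤n
    ... | true =
      let A∈H , ∣A∣≡k = level⁻ H k A (proj₁ (containing⁻ (level H k) S A A∈P)) in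
      ≤-trans (≤-reflexive (trans (*-identityʳ (μ ∸ k)) (cong (μ ∸_) (sym ∣A∣≡k)))) (degree A∈H)
    f≤g : ∀ x A → f x A ≤ g x (toggle x A)
    f≤g x A = ⟦⟧-mono (P A ∧ (not (lookup A x) ∧ H (toggle x A))) _ λ e →
      let A∈P , e′ = ∧⁻ (P A) e
          x∉A , A+x∈H = ∧⁻ (not (lookup A x)) e′
          A∈level , S⊆A = containing⁻ (level H k) S A A∈P
          _ , ∣A∣≡k = level⁻ H k A A∈level
          x∉A′ = lookup⇒∉ {A = A} x∉A
      in ∧⁺ (containing⁺ (level H (suc k)) S (toggle x A) (level⁺ H (toggle x A) A+x∈H (trans (∣toggle∣-∉ x∉A′) (cong suc ∣A∣≡k))) (⊆-trans S⊆A (⊆-toggle x∉A′)))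
            (∧⁺ (lookup⁺ (∉⇒∈-toggle x∉A′)) (∉⇒lookup (x∉A′ ∘ S⊆A)))
    below : ∀ A → ∑ (allFin n) (λ x → g x A) ≤ (suc k ∸ ∣ S ∣) * ⟦ Q A ⟧
    below A with Q A in A∈Q
    ... | false rewrite ∑-zero (allFin n) = z≤n
    ... | true =
      let A∈level , S⊆A = containing⁻ (level H (suc k)) S A A∈Q
          _ , ∣A∣≡ = level⁻ H (suc k) A A∈level
      in ≤-reflexive (trans (sym (m+n∸n≡m _ ∣ S ∣))
           (trans (cong (_∸ ∣ S ∣) (trans (∑-difference S⊆A) ∣A∣≡)) (sym (*-identityʳ (suc k ∸ ∣ S ∣)))))

  -- Deleting x maps the (k+1)-sets containing S ∪ {x} into the k-sets that contain S but not x.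
  N-insert : ∀ k {S x} → x ∉ S → (μ ∸ k) * N k (toggle x S) + (k ∸ ∣ S ∣) * N k (toggle x S) ≤ (k ∸ ∣ S ∣) * N k S
  N-insert k {S} {x} x∉S = begin
    -- `N-lift` is applied to `S ∪ {x}`. As this set has one more point than `S`, the factor on the
    -- right becomes `k ∸ ∣ S ∣`, so both terms share the factor `e`.
    (μ ∸ k) * N k S+x + e * N k S+x                ≤⟨ +-monoˡ-≤ (e * N k S+x) (N-lift k S+x) ⟩
    (suc k ∸ ∣ S+x ∣) * N (suc k) S+x + e * N k S+x ≡⟨ cong (λ i → (suc k ∸ i) * N (suc k) S+x + e * N k S+x) (∣toggle∣-∉ x∉S) ⟩
    e * N (suc k) S+x + e * N k S+x                ≤⟨ +-monoˡ-≤ (e * N k S+x) (*-monoʳ-≤ e delete) ⟩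
    e * card avoid + e * N k S+x                   ≡⟨ *-distribˡ-+ e (card avoid) (N k S+x) ⟨
    e * (card avoid + N k S+x)                     ≤⟨ *-monoʳ-≤ e (card-disjoint avoid⊑ S+x⊑ disjoint) ⟩
    e * N k S                                      ∎
    where
    open ≤-Reasoning
    e = k ∸ ∣ S ∣
    S+x = toggle x S
    avoid : Family n
    avoid A = containing (level H k) S A ∧ not (lookup A x)
    avoid⊑ : avoid ⊑ containing (level H k) S
    avoid⊑ A A∈ = proj₁ (∧⁻ (containing (level H k) S A) A∈)
    S+x⊑ : containing (level H k) S+x ⊑ containing (level H k) S
    S+x⊑ A A∈ = let A∈level , S+x⊆A = containing⁻ (level H k) S+x A A∈ in
      containing⁺ (level H k) S A A∈level (⊆-trans (⊆-toggle x∉S) S+x⊆A)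
    disjoint : ∀ A → A ∈F avoid → ¬ (A ∈F containing (level H k) S+x)
    disjoint A A∈ A∈′ = lookup⇒∉ {A = A} (proj₂ (∧⁻ (containing (level H k) S A) A∈))
      (proj₂ (containing⁻ (level H k) S+x A A∈′) (∉⇒∈-toggle x∉S))
    delete : N (suc k) S+x ≤ card avoid
    delete = begin
      N (suc k) S+x                                     ≡⟨ card-∑ (containing (level H (suc k)) S+x) ⟩
      ∑ˢ (⟦_⟧ ∘ containing (level H (suc k)) S+x)       ≤⟨ ∑-mono (allSubsets n) (λ A → ⟦⟧-mono (containing (level H (suc k)) S+x A) _ (removed A)) ⟩
      ∑ˢ (⟦_⟧ ∘ avoid ∘ toggle x)                       ≡⟨ ∑ˢ-toggle x (⟦_⟧ ∘ avoid) ⟩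
      ∑ˢ (⟦_⟧ ∘ avoid)                                  ≡⟨ card-∑ avoid ⟨
      card avoid                                        ∎
      where
      removed : ∀ A → A ∈F containing (level H (suc k)) S+x → toggle x A ∈F avoid
      removed A A∈ =
        let A∈level , S+x⊆A = containing⁻ (level H (suc k)) S+x A A∈
            A∈H , ∣A∣≡ = level⁻ H (suc k) A A∈level
            x∈A = S+x⊆A (∉⇒∈-toggle x∉S)
        in ∧⁺ (containing⁺ (level H k) S (toggle x A) (level⁺ H (toggle x A) (her A (toggle x A) A∈H (toggle-⊆ x∈A)) (suc-injective (trans (∣toggle∣-∈ x∈A) ∣A∣≡)))
                 (λ {y} y∈S → ∈-toggle (λ { refl → x∉S y∈S }) (S+x⊆A (⊆-toggle x∉S y∈S))))
              (∉⇒lookup (∈⇒∉-toggle x∈A))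

-- Set differences and the intersection of a family

∈─⇒∉ : ∀ (A B : Subset n) {x} → x ∈ A ─ B → x ∉ B
∈─⇒∉ (a ∷ A) (outside ∷ B) {zero}  x∈ ()
∈─⇒∉ (a ∷ A) (inside ∷ B)  {zero}  () _
∈─⇒∉ (a ∷ A) (b ∷ B)       {suc x} (there x∈) (there x∈B) = ∈─⇒∉ A B x∈ x∈B

-- Maximality is stated in contrapositive form, so that a set not inside `I` comes with a member of
-- the family that fails to contain it.
IsIntersection : Family n → Subset n → Set
IsIntersection F I = (∀ A → A ∈F F → I ⊆ A) × (∀ S → S ⊈ I → ∃ λ A → A ∈F F × S ⊈ A)

intersection : (F : Family n) → ∃ (IsIntersection F)
intersection {n} F = let I , I⊆ , maximal = go (allSubsets n) in I , (λ A → I⊆ A (∈-allSubsets A)) , maximal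
  where
  go : ∀ xs → ∃ λ I → (∀ A → A ∈ᴸ xs → A ∈F F → I ⊆ A) × (∀ S → S ⊈ I → ∃ λ A → A ∈F F × S ⊈ A)
  -- The empty intersection is the whole ground set, which no set fails to be inside.
  go [] = ⊤ , (λ _ ()) , λ S S⊈⊤ → ⊥-elim (S⊈⊤ ⊆⊤)
  go (A ∷ xs) with F A in A∈F | go xs
  ... | false | I , I⊆ , maximal = I , (λ { B (here refl) B∈F → case trans (sym A∈F) B∈F of λ ()
                                           ; B (there B∈xs) B∈F → I⊆ B B∈xs B∈F }) , maximal
  ... | true  | I , I⊆ , maximal = A ∩ I
    , (λ { B (here refl) B∈F → p∩q⊆p A I ; B (there B∈xs) B∈F → ⊆-trans (p∩q⊆q A I) (I⊆ B B∈xs B∈F) })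
    , λ S S⊈ → case S ⊆? A of λ
        { (no S⊈A)  → A , A∈F , S⊈A
        ; (yes S⊆A) → maximal S λ S⊆I → S⊈ λ x∈S → x∈p∩q⁺ (S⊆A x∈S , S⊆I x∈S) }

-- Upper bounds for cross-t-intersecting pairs

module Bounds
  {n : ℕ} (H : Family n) (her : Hereditary H) (μ : ℕ) (bases : ∀ B → IsBase H B → μ ≤ ∣ B ∣)
  (t r s M : ℕ) (t≤r : t ≤ r) (r≤s : r ≤ s) (μ-large : r + (s ∸ t) * M ≤ μ)
  -- `M` stays abstract, and each inequality pays for a halving: this one for `2𝒜≤` in
  -- `concentrated`, the next for `lower-level`, the third for `dispersed`, and the one with the
  -- extra `r ∸ t` for `most-gained`.
  (2[s-t+1]≤M : 2 * (suc s ∸ t) ≤ M)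
  (2[sCt]≤M : 2 * (s C t) ≤ M)
  (2[rCt][r-t+1]≤M : 2 * (r C t) * (suc r ∸ t) ≤ M)
  (2[rCt][r-t+1]+[r-t]≤M : t < r → 2 * (r C t) * (suc r ∸ t) + (r ∸ t) ≤ M)
  (1≤rCt : 1 ≤ r C t) (1≤sCt : 1 ≤ s C t)
  where

  open LargeBases H her μ bases

  2≤M : 2 ≤ M
  2≤M = ≤-trans (*-monoʳ-≤ 2 1≤sCt) 2[sCt]≤M

  instance
    M≢0 : NonZero M
    M≢0 = >-nonZero (≤-trans (s≤s z≤n) 2≤M)
    rCt≢0 : NonZero (r C t)
    rCt≢0 = >-nonZero 1≤rCt
    sCt≢0 : NonZero (s C t)
    sCt≢0 = >-nonZero 1≤sCt

  -- `N-insert` divided by `e = k ∸ ∣ S ∣`. Since `e ≤ s ∸ t` and `∣ S ∣ ≤ r`, the lower bound on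
  -- `μ` makes the coefficient `μ ∸ k + e` at least `e * M`.
  M*N-insert : ∀ {k S x} → k ≤ s → t ≤ ∣ S ∣ → ∣ S ∣ ≤ r → x ∉ S → M * N k (toggle x S) ≤ N k S
  M*N-insert {k} {S} {x} k≤s t≤S S≤r x∉S with ∣ S ∣ <? k
  -- A `k`-set is too small to contain `S ∪ {x}`, so the left side is zero.
  ... | no S≮k = ≤-trans (≤-reflexive (trans (cong (M *_) (card-empty none)) (*-zeroʳ M))) z≤n
    where
    none : ∀ A → ¬ (A ∈F containing (level H k) (toggle x S))
    none A A∈ = let A∈level , S+x⊆A = containing⁻ (level H k) (toggle x S) A A∈ in
      S≮k (≤-trans (≤-reflexive (sym (∣toggle∣-∉ x∉S)))
            (≤-trans (p⊆q⇒∣p∣≤∣q∣ S+x⊆A) (≤-reflexive (proj₂ (level⁻ H k A A∈level)))))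
  ... | yes S<k = *-cancelˡ-≤ e {{>-nonZero (m<n⇒0<n∸m S<k)}} (begin
    e * (M * N′)              ≡⟨ *-assoc e M N′ ⟨
    e * M * N′                ≤⟨ *-monoˡ-≤ N′ eM≤ ⟩
    (μ ∸ k + e) * N′          ≡⟨ *-distribʳ-+ N′ (μ ∸ k) e ⟩
    (μ ∸ k) * N′ + e * N′     ≤⟨ N-insert k x∉S ⟩
    e * N k S                 ∎)
    where
    open ≤-Reasoning
    e = k ∸ ∣ S ∣
    N′ = N k (toggle x S)
    eM≤ : e * M ≤ μ ∸ k + e
    eM≤ = +-cancelʳ-≤ ∣ S ∣ _ _ (begin
      e * M + ∣ S ∣            ≤⟨ +-mono-≤ (*-monoˡ-≤ M (∸-mono k≤s t≤S)) S≤r ⟩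
      (s ∸ t) * M + r          ≡⟨ +-comm _ r ⟩
      r + (s ∸ t) * M          ≤⟨ μ-large ⟩
      μ                        ≤⟨ m≤n+m∸n μ k ⟩
      k + (μ ∸ k)              ≡⟨ +-comm k _ ⟩
      μ ∸ k + k                ≡⟨ cong (μ ∸ k +_) (m∸n+n≡m (<⇒≤ S<k)) ⟨
      μ ∸ k + (e + ∣ S ∣)      ≡⟨ +-assoc (μ ∸ k) e ∣ S ∣ ⟨
      μ ∸ k + e + ∣ S ∣        ∎)

  -- A set meeting A in t elements meets every (∣A∣ - t + 1)-subset of A, and such a subset exists outside S.
  hit : ∀ {k} S A → k ≤ s → t ≤ ∣ S ∣ → ∣ S ∣ ≤ r → ∣ A ∩ S ∣ < t →
    M * card (meetingIn (containing (level H k) S) A t) ≤ (suc ∣ A ∣ ∸ t) * N k S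
  hit {k} S A k≤s t≤S S≤r A∩S<t with kSubset (A ─ S) (suc ∣ A ∣ ∸ t) (m≤n+o⇒m∸n≤o (suc ∣ A ∣) t
      (≤-trans (≤-reflexive (cong suc (sym (∣∣-split A S)))) (+-monoˡ-≤ ∣ A ─ S ∣ A∩S<t)))
  ... | W , W⊆A─S , ∣W∣≡ = begin
    M * card (meetingIn (containing (level H k) S) A t)
      ≤⟨ union-bound _ (allFin n) (lookup W) (λ x → containing (level H k) (toggle x S)) M (N k S) covers
           (λ x x∈W → M*N-insert k≤s t≤S S≤r (∈─⇒∉ A S (W⊆A─S (lookup⁻ x∈W)))) ⟩
    ∑ (allFin n) (⟦_⟧ ∘ lookup W) * N k S   ≡⟨ cong (_* N k S) (trans (sym (∣∣-∑ W)) ∣W∣≡) ⟩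
    (suc ∣ A ∣ ∸ t) * N k S                 ∎
    where
    open ≤-Reasoning
    W⊆A : W ⊆ A
    W⊆A = ⊆-trans W⊆A─S (p─q⊆p A S)
    covers : ∀ B → B ∈F meetingIn (containing (level H k) S) A t →
      ∃ λ x → x ∈ᴸ allFin n × lookup W x ≡ true × B ∈F containing (level H k) (toggle x S)
    covers B B∈ with meetingIn⁻ (containing (level H k) S) A t B B∈ | nonempty? (W ∩ B)
    ... | B∈c , t≤ | yes (x , x∈) =
      let B∈level , S⊆B = containing⁻ (level H k) S B B∈c
          x∈W , x∈B = x∈p∩q⁻ W B x∈
      in x , ∈-allFin x , lookup⁺ x∈W , containing⁺ (level H k) (toggle x S) B B∈level (insert-⊆ S⊆B x∈B)
    -- Otherwise `W` and `B ∩ A` would be disjoint subsets of `A` with at least `suc ∣ A ∣` elements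
    -- together.
    ... | B∈c , t≤ | no empty = contradiction (begin
      suc ∣ A ∣                    ≤⟨ m≤n+m∸n (suc ∣ A ∣) t ⟩
      t + (suc ∣ A ∣ ∸ t)          ≡⟨ cong (t +_) ∣W∣≡ ⟨
      t + ∣ W ∣                    ≤⟨ +-monoˡ-≤ ∣ W ∣ t≤ ⟩
      ∣ B ∩ A ∣ + ∣ W ∣            ≤⟨ +-mono-≤ (p⊆q⇒∣p∣≤∣q∣ B∩A⊆A─W) (⊆⇒∣∣≤∣∩∣ W⊆A id) ⟩
      ∣ A ─ W ∣ + ∣ A ∩ W ∣        ≡⟨ +-comm ∣ A ─ W ∣ _ ⟩
      ∣ A ∩ W ∣ + ∣ A ─ W ∣        ≡⟨ ∣∣-split A W ⟩
      ∣ A ∣                        ∎) (<-irrefl refl)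
      where
      B∩A⊆A─W : B ∩ A ⊆ A ─ W
      B∩A⊆A─W x∈ = let x∈B , x∈A = x∈p∩q⁻ B A x∈ in
        x∈p∧x∉q⇒x∈p─q x∈A λ x∈W → empty (_ , x∈p∩q⁺ (x∈W , x∈B))

  -- A `t`-set not inside `A` meets `A` in fewer than `t` elements, so `hit` applies to the members
  -- of `𝓕` above `S`.
  hit-⊈ : ∀ {k} (𝓕 : Family n) S A → k ≤ s → ∣ S ∣ ≡ t → S ⊈ A → 𝓕 ⊑ level H k → (∀ B → B ∈F 𝓕 → t ≤ ∣ A ∩ B ∣) →
    M * card (containing 𝓕 S) ≤ (suc ∣ A ∣ ∸ t) * N k S
  hit-⊈ {k} 𝓕 S A k≤s ∣S∣≡t S⊈A 𝓕⊑ meets = ≤-trans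
    (*-monoʳ-≤ M (card-mono λ B B∈ → let B∈𝓕 , S⊆B = containing⁻ 𝓕 S B B∈ in
      meetingIn⁺ (containing (level H k) S) A B (containing⁺ (level H k) S B (𝓕⊑ B B∈𝓕) S⊆B)
        (≤-trans (meets B B∈𝓕) (≤-reflexive (∣∩∣-comm A B)))))
    (hit S A k≤s (≤-reflexive (sym ∣S∣≡t)) (≤-trans (≤-reflexive ∣S∣≡t) t≤r)
      (≤-trans (s≤s (≤-reflexive (∣∩∣-comm A S))) (≤-trans (⊈⇒∣∩∣< S⊈A) (≤-reflexive ∣S∣≡t))))

  -- Every member of `𝓕` contains one of the `∣ A ∣ C t` subsets of `A` of size `t`.
  t-union-bound : ∀ (𝓕 : Family n) A k w → (∀ B → B ∈F 𝓕 → t ≤ ∣ A ∩ B ∣) →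
    (∀ S → S ⊆ A → ∣ S ∣ ≡ t → k * card (containing 𝓕 S) ≤ w) →
    k * card 𝓕 ≤ (∣ A ∣ C t) * w
  t-union-bound 𝓕 A k w meets bound = ≤-trans
    (union-bound 𝓕 (allSubsets n) (subsetsOf A t) (containing 𝓕) k w covers
      (λ S S∈ → let S⊆A , e = subsetsOf⁻ A t S S∈ in bound S S⊆A e))
    (≤-reflexive (cong (_* w) (∑-subsetsOf A t)))
    where
    covers : ∀ B → B ∈F 𝓕 → ∃ λ S → S ∈ᴸ allSubsets n × S ∈F subsetsOf A t × B ∈F containing 𝓕 S
    covers B B∈ = let S , S⊆ , e = kSubset (A ∩ B) t (meets B B∈) in
      S , ∈-allSubsets S , ∧⁺ (dec-true (S ⊆? A) (⊆-trans S⊆ (p∩q⊆p A B))) (≡ᵇ⁺ e) ,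
      containing⁺ 𝓕 S B B∈ (⊆-trans S⊆ (p∩q⊆q A B))

  -- Climbs one level at a time with `N-lift`, whose left factor `μ ∸ k` is at least its right
  -- factor `suc k ∸ t`.
  N-mono : ∀ S {k} → ∣ S ∣ ≡ t → suc r ≤′ k → k ≤ s → N (suc r) S ≤ N k S
  N-mono S ∣S∣≡t ≤′-refl k≤s = ≤-refl
  N-mono S {suc k} ∣S∣≡t (≤′-step r<k) k<s = ≤-trans (N-mono S ∣S∣≡t r<k (<⇒≤ k<s))
    (*-cancelˡ-≤ (suc k ∸ t) {{>-nonZero (m<n⇒0<n∸m (s≤s (≤-trans t≤r (<⇒≤ (≤′⇒≤ r<k)))))}} (begin
      (suc k ∸ t) * N k S             ≤⟨ *-monoˡ-≤ (N k S) k+1-t≤μ-k ⟩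
      (μ ∸ k) * N k S                 ≤⟨ N-lift k S ⟩
      (suc k ∸ ∣ S ∣) * N (suc k) S   ≡⟨ cong (λ i → (suc k ∸ i) * N (suc k) S) ∣S∣≡t ⟩
      (suc k ∸ t) * N (suc k) S       ∎))
    where
    open ≤-Reasoning
    -- After adding `k`, the left side is at most `t + 2 * (s ∸ t)`, and `2 ≤ M` brings this below
    -- `μ`.
    k+1-t≤μ-k : suc k ∸ t ≤ μ ∸ k
    k+1-t≤μ-k = m+n≤o⇒m≤o∸n (suc k ∸ t) (begin
      suc k ∸ t + k                  ≤⟨ +-mono-≤ (∸-monoˡ-≤ t k<s) (<⇒≤ k<s) ⟩
      s ∸ t + s                      ≤⟨ +-monoʳ-≤ (s ∸ t) (m≤n+m∸n s t) ⟩
      s ∸ t + (t + (s ∸ t))          ≤⟨ +-monoʳ-≤ (s ∸ t) (+-monoˡ-≤ (s ∸ t) t≤r) ⟩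
      s ∸ t + (r + (s ∸ t))          ≡⟨ solve 2 (λ a b → a :+ (b :+ a) := b :+ a :* con 2) refl (s ∸ t) r ⟩
      r + (s ∸ t) * 2                ≤⟨ +-monoʳ-≤ r (*-monoʳ-≤ (s ∸ t) 2≤M) ⟩
      r + (s ∸ t) * M                ≤⟨ μ-large ⟩
      μ                              ∎)
      where open +-*-Solver

  -- The factor `M` is gained entirely in the step from level `r` to `suc r`, where
  -- `(s ∸ t) * M ≤ μ ∸ r` and `suc r ∸ t ≤ s ∸ t`; `N-mono` does the rest.
  M*Nr≤Ns : ∀ S → ∣ S ∣ ≡ t → r < s → M * N r S ≤ N s S
  M*Nr≤Ns S ∣S∣≡t r<s = ≤-trans
    (*-cancelˡ-≤ (s ∸ t) {{>-nonZero (m<n⇒0<n∸m (≤-<-trans t≤r r<s))}} (begin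
      (s ∸ t) * (M * N r S)           ≡⟨ *-assoc (s ∸ t) M _ ⟨
      (s ∸ t) * M * N r S             ≤⟨ *-monoˡ-≤ (N r S) (m+n≤o⇒m≤o∸n ((s ∸ t) * M) (≤-trans (≤-reflexive (+-comm _ r)) μ-large)) ⟩
      (μ ∸ r) * N r S                 ≤⟨ N-lift r S ⟩
      (suc r ∸ ∣ S ∣) * N (suc r) S   ≡⟨ cong (λ i → (suc r ∸ i) * N (suc r) S) ∣S∣≡t ⟩
      (suc r ∸ t) * N (suc r) S       ≤⟨ *-monoˡ-≤ (N (suc r) S) (∸-monoˡ-≤ t r<s) ⟩
      (s ∸ t) * N (suc r) S           ∎))
    (N-mono S ∣S∣≡t (≤⇒≤′ r<s) ≤-refl)
    where open ≤-Reasoning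

  candidate : Subset n → ℕ
  candidate I = card (containing (level H r) I) + card (meetingIn (level H s) I t)

  module _ (K : ℕ) (candidate≤K : ∀ I → I ∈F H → t ≤ ∣ I ∣ → ∣ I ∣ ≤ r → candidate I ≤ K) where

    -- If `S` is in `H`, it is itself an allowed choice of `I`, and every `s`-set above it is
    -- counted in `candidate S`. If not, heredity leaves no `s`-set above it.
    Ns≤K : ∀ S → ∣ S ∣ ≡ t → N s S ≤ K
    Ns≤K S ∣S∣≡t with H S in S∈H
    ... | true = ≤-trans
      (≤-trans (card-mono λ B B∈ → let B∈level , S⊆B = containing⁻ (level H s) S B B∈ in
          meetingIn⁺ (level H s) S B B∈level (≤-trans (≤-reflexive (sym ∣S∣≡t)) (⊆⇒∣∣≤∣∩∣ S⊆B id)))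
        (m≤n+m _ (card (containing (level H r) S))))
      (candidate≤K S S∈H (≤-reflexive (sym ∣S∣≡t)) (≤-trans (≤-reflexive ∣S∣≡t) t≤r))
    ... | false = ≤-trans (≤-reflexive (card-empty λ B B∈ →
        let B∈level , S⊆B = containing⁻ (level H s) S B B∈ in
        case trans (sym (her B S (proj₁ (level⁻ H s B B∈level)) S⊆B)) S∈H of λ ())) z≤n

    -- No `t`-subset `S` of `A₀` lies inside `I`, so some `A` in `𝒜` fails to contain it. The
    -- members of `ℬ` above `S` still meet `A` in `t` elements, so they are few; summing over the
    -- `r C t` choices of `S` gives the bound.
    dispersed : ∀ 𝒜 ℬ {A₀ I} → A₀ ∈F 𝒜 → 𝒜 ⊑ level H r → ℬ ⊑ level H s → CrossIntersecting 𝒜 ℬ t →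
      IsIntersection 𝒜 I → ∣ I ∣ < t → 2 * card ℬ ≤ K
    dispersed 𝒜 ℬ {A₀} {I} A₀∈𝒜 𝒜⊑ ℬ⊑ cross (I⊆ , maximal) I<t = *-cancelˡ-≤ M (begin
      M * (2 * card ℬ)                             ≡⟨ solve 2 (λ m b → m :* (con 2 :* b) := con 2 :* (m :* b)) refl M (card ℬ) ⟩
      2 * (M * card ℬ)                             ≤⟨ *-monoʳ-≤ 2 (t-union-bound ℬ A₀ M ((suc r ∸ t) * K) (λ B → cross A₀ B A₀∈𝒜) bound) ⟩
      2 * ((∣ A₀ ∣ C t) * ((suc r ∸ t) * K))       ≡⟨ cong (λ i → 2 * ((i C t) * ((suc r ∸ t) * K))) (size A₀ A₀∈𝒜) ⟩
      2 * ((r C t) * ((suc r ∸ t) * K))            ≡⟨ solve 3 (λ a b k → con 2 :* (a :* (b :* k)) := con 2 :* a :* b :* k) refl (r C t) (suc r ∸ t) K ⟩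
      2 * (r C t) * (suc r ∸ t) * K                ≤⟨ *-monoˡ-≤ K 2[rCt][r-t+1]≤M ⟩
      M * K                                        ∎)
      where
      open ≤-Reasoning
      open +-*-Solver
      size : ∀ A → A ∈F 𝒜 → ∣ A ∣ ≡ r
      size A A∈ = proj₂ (level⁻ H r A (𝒜⊑ A A∈))
      bound : ∀ S → S ⊆ A₀ → ∣ S ∣ ≡ t → M * card (containing ℬ S) ≤ (suc r ∸ t) * K
      bound S _ ∣S∣≡t with maximal S (λ S⊆I → <-irrefl ∣S∣≡t (≤-<-trans (p⊆q⇒∣p∣≤∣q∣ S⊆I) I<t))
      ... | A , A∈ , S⊈A = begin
        M * card (containing ℬ S)     ≤⟨ hit-⊈ ℬ S A ≤-refl ∣S∣≡t S⊈A ℬ⊑ (λ B → cross A B A∈) ⟩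
        (suc ∣ A ∣ ∸ t) * N s S       ≡⟨ cong (λ i → (suc i ∸ t) * N s S) (size A A∈) ⟩
        (suc r ∸ t) * N s S           ≤⟨ *-monoʳ-≤ (suc r ∸ t) (Ns≤K S ∣S∣≡t) ⟩
        (suc r ∸ t) * K               ∎

    -- One `B₀` in `ℬ` suffices: each member of `𝒜` contains one of its `s C t` subsets `S` of size
    -- `t`, and the `r`-sets above `S` are fewer than the `s`-sets by the factor `M`.
    lower-level : ∀ 𝒜 ℬ {B₀} → B₀ ∈F ℬ → 𝒜 ⊑ level H r → ℬ ⊑ level H s → CrossIntersecting 𝒜 ℬ t →
      r < s → 2 * card 𝒜 ≤ K
    lower-level 𝒜 ℬ {B₀} B₀∈ℬ 𝒜⊑ ℬ⊑ cross r<s = *-cancelˡ-≤ (s C t) (begin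
      (s C t) * (2 * card 𝒜)          ≡⟨ solve 2 (λ m b → m :* (con 2 :* b) := con 2 :* m :* b) refl (s C t) (card 𝒜) ⟩
      2 * (s C t) * card 𝒜            ≤⟨ t-union-bound 𝒜 B₀ (2 * (s C t)) K
                                           (λ A A∈ → ≤-trans (cross A B₀ A∈ B₀∈ℬ) (≤-reflexive (∣∩∣-comm A B₀))) bound ⟩
      (∣ B₀ ∣ C t) * K                ≡⟨ cong (λ i → (i C t) * K) (proj₂ (level⁻ H s B₀ (ℬ⊑ B₀ B₀∈ℬ))) ⟩
      (s C t) * K                     ∎)
      where
      open ≤-Reasoning
      open +-*-Solver
      bound : ∀ S → S ⊆ B₀ → ∣ S ∣ ≡ t → 2 * (s C t) * card (containing 𝒜 S) ≤ K
      bound S _ ∣S∣≡t = begin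
        2 * (s C t) * card (containing 𝒜 S)
          ≤⟨ *-mono-≤ 2[sCt]≤M (card-mono λ A A∈ → let A∈𝒜 , S⊆A = containing⁻ 𝒜 S A A∈ in
               containing⁺ (level H r) S A (𝒜⊑ A A∈𝒜) S⊆A) ⟩
        M * N r S    ≤⟨ M*Nr≤Ns S ∣S∣≡t r<s ⟩
        N s S        ≤⟨ Ns≤K S ∣S∣≡t ⟩
        K            ∎

    concentrated : ∀ 𝒜 ℬ {A₀ I} → A₀ ∈F 𝒜 → 𝒜 ⊑ level H r → ℬ ⊑ level H s → CrossIntersecting 𝒜 ℬ t →
      IsIntersection 𝒜 I → t ≤ ∣ I ∣ → card 𝒜 + card ℬ ≤ K
    concentrated 𝒜 ℬ {A₀} {I} A₀∈𝒜 𝒜⊑ ℬ⊑ cross (I⊆ , maximal) t≤I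
      with anySubset? (λ B → (ℬ B Bool.≟ true) ×-dec ¬? (t ≤? ∣ B ∩ I ∣))
    ... | no none = ≤-trans
      (+-mono-≤ (card-mono λ A A∈ → containing⁺ (level H r) I A (𝒜⊑ A A∈) (I⊆ A A∈))
                (card-mono λ B B∈ → meetingIn⁺ (level H s) I B (ℬ⊑ B B∈)
                  (≮⇒≥ λ <t → none (B , B∈ , <⇒≱ <t))))
      (candidate≤K I (her A₀ I (proj₁ (level⁻ H r A₀ (𝒜⊑ A₀ A₀∈𝒜))) (I⊆ A₀ A₀∈𝒜)) t≤I
        (≤-trans (p⊆q⇒∣p∣≤∣q∣ (I⊆ A₀ A₀∈𝒜)) (≤-reflexive (proj₂ (level⁻ H r A₀ (𝒜⊑ A₀ A₀∈𝒜))))))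
    -- Twice the sum is split in two: `N r I` and one copy of `b` form `candidate I`, while `D + b`
    -- fits into the second summand of `candidate A₀`.
    ... | yes (B₀ , B₀∈ℬ , B₀∩I≱t) = *-cancelˡ-≤ 2 (begin
      2 * (card 𝒜 + card ℬ)
        ≤⟨ *-monoʳ-≤ 2 (+-monoʳ-≤ (card 𝒜) (≤-trans (card≤meeting+missing ℬ I t) (+-monoˡ-≤ (card (missing ℬ I t)) meeting≤))) ⟩
      2 * (card 𝒜 + (b + card (missing ℬ I t)))
        ≡⟨ solve 3 (λ a b m → con 2 :* (a :+ (b :+ m)) := con 2 :* a :+ (con 2 :* b :+ con 2 :* m)) refl (card 𝒜) b (card (missing ℬ I t)) ⟩
      2 * card 𝒜 + (2 * b + 2 * card (missing ℬ I t))
        ≤⟨ +-mono-≤ 2𝒜≤ (+-monoʳ-≤ (2 * b) 2missing≤) ⟩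
      N r I + (2 * b + D)
        ≡⟨ solve 3 (λ h b d → h :+ (con 2 :* b :+ d) := (h :+ b) :+ (d :+ b)) refl (N r I) b D ⟩
      candidate I + (D + b)
        ≤⟨ +-mono-≤ (candidate≤K I I∈H t≤I I≤r) (≤-trans D+b≤ (m≤n+m _ (card (containing (level H r) A₀)))) ⟩
      K + candidate A₀
        ≤⟨ +-monoʳ-≤ K (candidate≤K A₀ A₀∈H (≤-trans t≤r (≤-reflexive (sym ∣A₀∣≡r))) (≤-reflexive ∣A₀∣≡r)) ⟩
      K + K
        ≡⟨ solve 1 (λ k → k :+ k := con 2 :* k) refl K ⟩
      2 * K ∎)
      where
      open ≤-Reasoning
      open +-*-Solver
      A₀∈H : A₀ ∈F H
      A₀∈H = proj₁ (level⁻ H r A₀ (𝒜⊑ A₀ A₀∈𝒜))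
      size : ∀ A → A ∈F 𝒜 → ∣ A ∣ ≡ r
      size A A∈ = proj₂ (level⁻ H r A (𝒜⊑ A A∈))
      ∣A₀∣≡r : ∣ A₀ ∣ ≡ r
      ∣A₀∣≡r = size A₀ A₀∈𝒜
      I⊆A₀ : I ⊆ A₀
      I⊆A₀ = I⊆ A₀ A₀∈𝒜
      I∈H : I ∈F H
      I∈H = her A₀ I A₀∈H I⊆A₀
      I≤r : ∣ I ∣ ≤ r
      I≤r = ≤-trans (p⊆q⇒∣p∣≤∣q∣ I⊆A₀) (≤-reflexive ∣A₀∣≡r)
      d = r ∸ t
      b D : ℕ
      b = card (meetingIn (level H s) I t)
      -- The `s`-sets that enter the second summand of the candidate when `I` is replaced by `A₀`.
      gained : Family n
      gained = missing (meetingIn (level H s) A₀ t) I t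
      D = card gained
      meeting≤ : card (meetingIn ℬ I t) ≤ b
      meeting≤ = card-mono λ B B∈ → let B∈ℬ , t≤ = meetingIn⁻ ℬ I t B B∈ in meetingIn⁺ (level H s) I B (ℬ⊑ B B∈ℬ) t≤
      D+b≤ : D + b ≤ card (meetingIn (level H s) A₀ t)
      D+b≤ = card-disjoint
        (λ B B∈ → proj₁ (missing⁻ (meetingIn (level H s) A₀ t) I t B B∈))
        (λ B B∈ → let B∈level , t≤ = meetingIn⁻ (level H s) I t B B∈ in
          meetingIn⁺ (level H s) A₀ B B∈level (≤-trans t≤ (∩-monoʳ B I⊆A₀)))
        (λ B B∈ B∈′ → proj₂ (missing⁻ (meetingIn (level H s) A₀ t) I t B B∈) (proj₂ (meetingIn⁻ (level H s) I t B B∈′)))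
      -- All members of `𝒜` contain `I` and meet `B₀` in `t` elements, although `I` itself does not;
      -- `hit` with `B₀` as the set to be met bounds them.
      2𝒜≤ : 2 * card 𝒜 ≤ N r I
      2𝒜≤ = *-cancelˡ-≤ M (begin
        M * (2 * card 𝒜)                 ≡⟨ solve 2 (λ m a → m :* (con 2 :* a) := con 2 :* (m :* a)) refl M (card 𝒜) ⟩
        2 * (M * card 𝒜)                 ≤⟨ *-monoʳ-≤ 2 (*-monoʳ-≤ M (card-mono λ A A∈ →
                                              meetingIn⁺ (containing (level H r) I) B₀ A (containing⁺ (level H r) I A (𝒜⊑ A A∈) (I⊆ A A∈)) (cross A B₀ A∈ B₀∈ℬ))) ⟩
        2 * (M * card (meetingIn (containing (level H r) I) B₀ t))
                                         ≤⟨ *-monoʳ-≤ 2 (hit I B₀ r≤s t≤I I≤r (≰⇒> B₀∩I≱t)) ⟩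
        2 * ((suc ∣ B₀ ∣ ∸ t) * N r I)   ≡⟨ cong (λ i → 2 * ((suc i ∸ t) * N r I)) (proj₂ (level⁻ H s B₀ (ℬ⊑ B₀ B₀∈ℬ))) ⟩
        2 * ((suc s ∸ t) * N r I)        ≡⟨ *-assoc 2 (suc s ∸ t) (N r I) ⟨
        2 * (suc s ∸ t) * N r I          ≤⟨ *-monoˡ-≤ (N r I) 2[s-t+1]≤M ⟩
        M * N r I                        ∎)
      missing⊑ : missing ℬ I t ⊑ level H s
      missing⊑ B B∈ = ℬ⊑ B (proj₁ (missing⁻ ℬ I t B B∈))
      bound : ∀ S → S ⊆ A₀ → ∣ S ∣ ≡ t → 2 * (r C t) * card (containing (missing ℬ I t) S) ≤ D
      bound S S⊆A₀ ∣S∣≡t with S ⊆? I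
      ... | yes S⊆I = ≤-trans (≤-reflexive (trans (cong (2 * (r C t) *_) (card-empty none)) (*-zeroʳ (2 * (r C t))))) z≤n
        where
        none : ∀ B → ¬ (B ∈F containing (missing ℬ I t) S)
        none B B∈ = let B∈m , S⊆B = containing⁻ (missing ℬ I t) S B B∈ in
          proj₂ (missing⁻ ℬ I t B B∈m) (≤-trans (≤-reflexive (sym ∣S∣≡t)) (⊆⇒∣∣≤∣∩∣ S⊆B S⊆I))
      -- Some `A` in `𝒜` fails to contain `S`, so `hit-⊈` makes the missing sets above `S` few
      -- compared with `N s S`; `most-gained` then compares `N s S` with `D`.
      ... | no S⊈I with maximal S S⊈I
      ...   | A , A∈ , S⊈A = *-cancelˡ-≤ M (begin
        M * (2 * (r C t) * g)              ≡⟨ solve 3 (λ m a g → m :* (a :* g) := a :* (m :* g)) refl M (2 * (r C t)) g ⟩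
        2 * (r C t) * (M * g)              ≤⟨ *-monoʳ-≤ (2 * (r C t)) (hit-⊈ (missing ℬ I t) S A ≤-refl ∣S∣≡t S⊈A missing⊑
                                                (λ B B∈ → cross A B A∈ (proj₁ (missing⁻ ℬ I t B B∈)))) ⟩
        2 * (r C t) * ((suc ∣ A ∣ ∸ t) * N s S) ≡⟨ cong (λ i → 2 * (r C t) * ((suc i ∸ t) * N s S)) (size A A∈) ⟩
        2 * (r C t) * ((suc r ∸ t) * N s S)  ≡⟨ *-assoc (2 * (r C t)) (suc r ∸ t) (N s S) ⟨
        2 * (r C t) * (suc r ∸ t) * N s S  ≤⟨ most-gained ⟩
        M * D                              ∎)
        where
        g = card (containing (missing ℬ I t) S)
        -- `S` lies in `A₀` but not in `I`, so `I` is a proper subset of `A₀`. This lowers the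
        -- factor `suc ∣ I ∣ ∸ t` from `hit` to at most `r ∸ t`.
        I<r : ∣ I ∣ < r
        I<r = let x , x∈S , x∉I = ⊈⇒∃ S⊈I in ≤-trans (p⊂q⇒∣p∣<∣q∣ (I⊆A₀ , x , S⊆A₀ x∈S , x∉I)) (≤-reflexive ∣A₀∣≡r)
        S∩I<t : ∣ I ∩ S ∣ < t
        S∩I<t = ≤-trans (s≤s (≤-reflexive (∣∩∣-comm I S))) (≤-trans (⊈⇒∣∩∣< S⊈I) (≤-reflexive ∣S∣≡t))
        𝓢 = containing (level H s) S
        -- Each `s`-set above `S` meets `A₀` in `t` elements, so it lies in `gained` unless it also
        -- meets `I` in `t` elements. The exceptions cost at most `d * N s S`, which is added to
        -- both sides.
        most-gained : 2 * (r C t) * (suc r ∸ t) * N s S ≤ M * D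
        most-gained = +-cancelʳ-≤ (d * N s S) _ _ (begin
          2 * (r C t) * (suc r ∸ t) * N s S + d * N s S    ≡⟨ *-distribʳ-+ (N s S) (2 * (r C t) * (suc r ∸ t)) d ⟨
          (2 * (r C t) * (suc r ∸ t) + d) * N s S          ≤⟨ *-monoˡ-≤ (N s S) (2[rCt][r-t+1]+[r-t]≤M (≤-<-trans t≤I I<r)) ⟩
          M * N s S                                        ≤⟨ *-monoʳ-≤ M (card≤meeting+missing 𝓢 I t) ⟩
          M * (card (meetingIn 𝓢 I t) + card (missing 𝓢 I t)) ≡⟨ *-distribˡ-+ M (card (meetingIn 𝓢 I t)) _ ⟩
          M * card (meetingIn 𝓢 I t) + M * card (missing 𝓢 I t)
            ≤⟨ +-mono-≤ (≤-trans (hit S I ≤-refl (≤-reflexive (sym ∣S∣≡t)) (≤-trans (≤-reflexive ∣S∣≡t) t≤r) S∩I<t)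
                                 (*-monoˡ-≤ (N s S) (∸-monoˡ-≤ t I<r)))
                        (*-monoʳ-≤ M (card-mono λ B B∈ →
                          let B∈𝓢 , t≰ = missing⁻ 𝓢 I t B B∈
                              B∈level , S⊆B = containing⁻ (level H s) S B B∈𝓢
                          in missing⁺ (meetingIn (level H s) A₀ t) I t B
                               (meetingIn⁺ (level H s) A₀ B B∈level (≤-trans (≤-reflexive (sym ∣S∣≡t)) (⊆⇒∣∣≤∣∩∣ S⊆B S⊆A₀))) t≰)) ⟩
          d * N s S + M * D                                ≡⟨ +-comm (d * N s S) _ ⟩
          M * D + d * N s S                                ∎)
      2missing≤ : 2 * card (missing ℬ I t) ≤ D
      2missing≤ = *-cancelˡ-≤ (r C t) (begin
        (r C t) * (2 * card (missing ℬ I t))   ≡⟨ solve 2 (λ m b → m :* (con 2 :* b) := con 2 :* m :* b) refl (r C t) (card (missing ℬ I t)) ⟩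
        2 * (r C t) * card (missing ℬ I t)     ≤⟨ t-union-bound (missing ℬ I t) A₀ (2 * (r C t)) D
                                                    (λ B B∈ → cross A₀ B A₀∈𝒜 (proj₁ (missing⁻ ℬ I t B B∈))) bound ⟩
        (∣ A₀ ∣ C t) * D                       ≡⟨ cong (λ i → (i C t) * D) ∣A₀∣≡r ⟩
        (r C t) * D                            ∎)

    halves : ∀ a b → 2 * a ≤ K → 2 * b ≤ K → a + b ≤ K
    halves a b 2a≤K 2b≤K = *-cancelˡ-≤ 2 (begin
      2 * (a + b)     ≡⟨ *-distribˡ-+ 2 a b ⟩
      2 * a + 2 * b   ≤⟨ +-mono-≤ 2a≤K 2b≤K ⟩
      K + K           ≡⟨ cong (K +_) (+-identityʳ K) ⟨
      2 * K           ∎)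
      where open ≤-Reasoning

    upper : ∀ 𝒜 ℬ → Admissible (level H r) (level H s) t 𝒜 ℬ → card 𝒜 + card ℬ ≤ K
    upper 𝒜 ℬ ((A₀ , A₀∈𝒜) , (B₀ , B₀∈ℬ) , 𝒜⊑ , ℬ⊑ , cross) with intersection 𝒜
    ... | I , I-⋂ with t ≤? ∣ I ∣ | r ≟ s
    ...   | yes t≤I | _ = concentrated 𝒜 ℬ A₀∈𝒜 𝒜⊑ ℬ⊑ cross I-⋂ t≤I
    ...   | no t≰I | no r≢s = halves (card 𝒜) (card ℬ)
      (lower-level 𝒜 ℬ B₀∈ℬ 𝒜⊑ ℬ⊑ cross (≤∧≢⇒< r≤s r≢s))
      (dispersed 𝒜 ℬ A₀∈𝒜 𝒜⊑ ℬ⊑ cross I-⋂ (≰⇒> t≰I))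
    -- For equal levels the roles can be exchanged: a large intersection of `ℬ` gives
    -- `concentrated`, and otherwise `dispersed` halves both families.
    ...   | no t≰I | yes r≡s = swapped (intersection ℬ)
      where
      𝒜⊑′ = subst (λ k → 𝒜 ⊑ level H k) r≡s 𝒜⊑
      ℬ⊑′ = subst (λ k → ℬ ⊑ level H k) (sym r≡s) ℬ⊑
      cross′ : CrossIntersecting ℬ 𝒜 t
      cross′ B A B∈ A∈ = ≤-trans (cross A B A∈ B∈) (≤-reflexive (∣∩∣-comm A B))
      swapped : ∃ (IsIntersection ℬ) → card 𝒜 + card ℬ ≤ K
      swapped (J , J-⋂) with t ≤? ∣ J ∣
      ... | yes t≤J = ≤-trans (≤-reflexive (+-comm (card 𝒜) (card ℬ)))
        (concentrated ℬ 𝒜 B₀∈ℬ ℬ⊑′ 𝒜⊑′ cross′ J-⋂ t≤J)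
      ... | no t≰J = halves (card 𝒜) (card ℬ)
        (dispersed ℬ 𝒜 B₀∈ℬ ℬ⊑′ 𝒜⊑′ cross′ J-⋂ (≰⇒> t≰J))
        (dispersed 𝒜 ℬ A₀∈𝒜 𝒜⊑ ℬ⊑ cross I-⋂ (≰⇒> t≰I))

-- Numerical estimates

-- Induction on the excess of `n` over `k`: in Pascal's rule one summand is positive and the other
-- is at least the previous bound.
n-k+1≤nCk : ∀ {n k} → 1 ≤ k → k ≤ n → suc n ∸ k ≤ n C k
n-k+1≤nCk {n} {suc k} 1≤k k≤n = begin
  n ∸ k                               ≡⟨ +-∸-assoc 1 k≤n ⟩
  suc (n ∸ suc k)                     ≤⟨ offset k (n ∸ suc k) ⟩
  (suc k + (n ∸ suc k)) C suc k       ≡⟨ cong (_C suc k) (m+[n∸m]≡n k≤n) ⟩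
  n C suc k                           ∎
  where
  open ≤-Reasoning
  offset : ∀ k d → suc d ≤ (suc k + d) C suc k
  positive : ∀ k d → 1 ≤ (k + suc d) C k
  offset k zero rewrite +-identityʳ k | nCn≡1 (suc k) = ≤-refl
  offset k (suc d) = begin
    1 + suc d                                 ≤⟨ +-mono-≤ (positive k d) (offset k d) ⟩
    (k + suc d) C k + (suc k + d) C suc k     ≡⟨ cong (λ m → (k + suc d) C k + m C suc k) (+-suc k d) ⟨
    (k + suc d) C k + (k + suc d) C suc k     ≡⟨ nCk+nC[k+1]≡[n+1]C[k+1] (k + suc d) k ⟩
    (suc k + suc d) C suc k                   ∎
  positive zero    d = ≤-refl
  positive (suc k) d = ≤-trans (s≤s z≤n) (offset k (suc d))

n<2^n : ∀ n → n < 2 ^ n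
n<2^n zero    = ≤-refl
n<2^n (suc n) = begin
  suc (suc n)       ≤⟨ +-mono-≤ (m^n>0 2 n) (n<2^n n) ⟩
  2 ^ n + 2 ^ n     ≡⟨ cong (2 ^ n +_) (+-identityʳ (2 ^ n)) ⟨
  2 ^ suc n         ∎
  where open ≤-Reasoning

module Constants (t r s : ℕ) (1≤t : 1 ≤ t) (t≤r : t ≤ r) (r≤s : r ≤ s) where

  M : ℕ
  M = (2 * (s C t)) ⊔ (2 ^ r * (r ∸ t) * (r C t) + 1)

  2[sCt]≤M : 2 * (s C t) ≤ M
  2[sCt]≤M = m≤m⊔n _ _

  2[s-t+1]≤M : 2 * (suc s ∸ t) ≤ M
  2[s-t+1]≤M = ≤-trans (*-monoʳ-≤ 2 (n-k+1≤nCk 1≤t (≤-trans t≤r r≤s))) 2[sCt]≤M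

  1≤nCt : ∀ {n} → t ≤ n → 1 ≤ n C t
  1≤nCt t≤n = ≤-trans (m<n⇒0<n∸m (s≤s t≤n)) (n-k+1≤nCk 1≤t t≤n)

  -- With `r ∸ t = suc e`, the claim reduces to `2 * (e + 2) ≤ 2 ^ r`. This holds since
  -- `e + 2 ≤ 2 ^ (e + 1)` and, by `1 ≤ t`, also `e + 2 ≤ r`.
  2[rCt][r-t+1]+[r-t]≤M : t < r → 2 * (r C t) * (suc r ∸ t) + (r ∸ t) ≤ M
  2[rCt][r-t+1]+[r-t]≤M t<r = begin
    2 * c′ * (suc r ∸ t) + (r ∸ t)         ≡⟨ cong₂ (λ i j → 2 * c′ * i + j) (trans (+-∸-assoc 1 t≤r) (cong suc d≡)) d≡ ⟩
    2 * c′ * suc (suc e) + suc e           ≤⟨ +-monoʳ-≤ (2 * c′ * suc (suc e)) (≤-trans (≤-reflexive (+-comm 1 e)) (+-monoˡ-≤ 1 e≤)) ⟩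
    2 * c′ * suc (suc e) + (e * (2 * suc (suc e) * c′) + 1)
      ≡⟨ solve 2 (λ a e → con 2 :* a :* (con 2 :+ e) :+ (e :* (con 2 :* (con 2 :+ e) :* a) :+ con 1)
                     := con 2 :* (con 2 :+ e) :* (con 1 :+ e) :* a :+ con 1) refl c′ e ⟩
    2 * suc (suc e) * suc e * c′ + 1       ≤⟨ +-monoˡ-≤ 1 (*-monoˡ-≤ c′ (*-monoˡ-≤ (suc e) 2[d+1]≤2^r)) ⟩
    2 ^ r * suc e * c′ + 1                 ≡⟨ cong (λ i → 2 ^ r * i * c′ + 1) d≡ ⟨
    2 ^ r * (r ∸ t) * c′ + 1               ≤⟨ m≤n⊔m (2 * (s C t)) _ ⟩
    M                                      ∎
    where
    open ≤-Reasoning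
    open +-*-Solver
    c′ = r C t
    e = r ∸ suc t
    d≡ : r ∸ t ≡ suc e
    d≡ = +-∸-assoc 1 t<r
    e≤ : e ≤ e * (2 * suc (suc e) * c′)
    e≤ = m≤m*n e (2 * suc (suc e) * c′) {{>-nonZero (*-mono-≤ {1} {2 * suc (suc e)} (s≤s z≤n) (1≤nCt t≤r))}}
    2[d+1]≤2^r : 2 * suc (suc e) ≤ 2 ^ r
    2[d+1]≤2^r = begin
      2 * suc (suc e)     ≤⟨ *-monoʳ-≤ 2 (n<2^n (suc e)) ⟩
      2 * 2 ^ suc e       ≤⟨ ^-monoʳ-≤ 2 (≤-trans (+-mono-≤ 1≤t (≤-reflexive (sym d≡))) (≤-reflexive (m+[n∸m]≡n t≤r))) ⟩
      2 ^ r               ∎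

  2[rCt][r-t+1]≤M : 2 * (r C t) * (suc r ∸ t) ≤ M
  2[rCt][r-t+1]≤M with t <? r
  ... | yes t<r = ≤-trans (m≤m+n _ (r ∸ t)) (2[rCt][r-t+1]+[r-t]≤M t<r)
  -- Now `t = r` and the left side is 2. The second entry of the maximum is only 1, so the first
  -- entry is used.
  ... | no t≮r = begin
    2 * (r C t) * (suc r ∸ t)    ≡⟨ cong (λ k → 2 * (r C k) * (suc r ∸ k)) (≤-antisym t≤r (≮⇒≥ t≮r)) ⟩
    2 * (r C r) * (suc r ∸ r)    ≡⟨ cong₂ (λ i j → 2 * i * j) (nCn≡1 r) (m+n∸n≡m 1 r) ⟩
    2 * 1                        ≤⟨ *-monoʳ-≤ 2 (1≤nCt (≤-trans t≤r r≤s)) ⟩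
    2 * (s C t)                  ≤⟨ 2[sCt]≤M ⟩
    M                            ∎
    where open ≤-Reasoning

-- Choice of an optimal `I` and attainment of the bound

theorem1p6 : (n t r s : ℕ) → 1 ≤ t → t ≤ r → r ≤ s →
    (H : Family n) → Hereditary H → μ≥ H (c r s t) →
    ∃ λ I → I ∈F H × t ≤ ∣ I ∣ × ∣ I ∣ ≤ r ×
    m≡ (level H r) (level H s) t
    (card (containing (level H r) I) + card (meetingIn (level H s) I t))
theorem1p6 n t r s 1≤t t≤r r≤s H her ((A , A∈H) , bases) =
  I , I∈H , t≤I , I≤r ,
  ( 𝒜 , ℬ
  , ((R , containing⁺ (level H r) I R (level⁺ H R R∈H ∣R∣≡r) I⊆R)
    , (S , meetingIn⁺ (level H s) I S (level⁺ H S S∈H ∣S∣≡s) (≤-trans t≤I (⊆⇒∣∣≤∣∩∣ I⊆S id)))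
    , (λ B B∈ → proj₁ (containing⁻ (level H r) I B B∈))
    , (λ B B∈ → proj₁ (meetingIn⁻ (level H s) I t B B∈))
    , cross)
  , refl )
  , upper (candidate I) (λ J J∈H t≤J J≤r → maximal J (J∈H , t≤J , J≤r))
  where
  open Constants t r s 1≤t t≤r r≤s
  open LargeBases H her (c r s t) bases using (extend)
  open Bounds H her (c r s t) bases t r s M t≤r r≤s ≤-refl 2[s-t+1]≤M 2[sCt]≤M
    2[rCt][r-t+1]≤M 2[rCt][r-t+1]+[r-t]≤M (1≤nCt t≤r) (1≤nCt (≤-trans t≤r r≤s))
  Feasible : Subset n → Set
  Feasible J = J ∈F H × t ≤ ∣ J ∣ × ∣ J ∣ ≤ r
  feasible? : ∀ J → Dec (Feasible J)
  feasible? J = (H J Bool.≟ true) ×-dec (t ≤? ∣ J ∣) ×-dec (∣ J ∣ ≤? r)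
  r≤c : r ≤ c r s t
  r≤c = m≤m+n r _
  s≤c : s ≤ c r s t
  s≤c = ≤-trans (m≤n+m∸n s t) (+-mono-≤ t≤r (m≤m*n (s ∸ t) M))
  -- The empty set extends to a `t`-set in `H`; this serves as the default value of `argmax`.
  first : ∃ Feasible
  first = let S , _ , S∈H , ∣S∣≡t = extend (her A ⊥ A∈H (⊆-min A)) (≤-trans (≤-reflexive (∣⊥∣≡0 n)) z≤n) (≤-trans t≤r r≤c)
          in S , S∈H , ≤-reflexive (sym ∣S∣≡t) , ≤-trans (≤-reflexive ∣S∣≡t) t≤r
  feasibles = filter feasible? (allSubsets n)
  I = argmax candidate (proj₁ first) feasibles
  I-feasible : Feasible I
  I-feasible = argmax-all candidate (proj₂ first) (all-filter feasible? (allSubsets n))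
  maximal : ∀ J → Feasible J → candidate J ≤ candidate I
  maximal J J-feasible = All.lookup (f[xs]≤f[argmax] (proj₁ first) feasibles) (∈-filter⁺ feasible? (∈-allSubsets J) J-feasible)
  I∈H = proj₁ I-feasible
  t≤I = proj₁ (proj₂ I-feasible)
  I≤r = proj₂ (proj₂ I-feasible)
  𝒜 = containing (level H r) I
  ℬ = meetingIn (level H s) I t
  -- Large bases let `I` grow within `H` to an `r`-set and to an `s`-set, so both extremal families
  -- are nonempty.
  R-data = extend I∈H I≤r r≤c
  R = proj₁ R-data
  I⊆R : I ⊆ R
  I⊆R = proj₁ (proj₂ R-data)
  R∈H = proj₁ (proj₂ (proj₂ R-data))
  ∣R∣≡r = proj₂ (proj₂ (proj₂ R-data))
  S-data = extend I∈H (≤-trans I≤r r≤s) s≤c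
  S = proj₁ S-data
  I⊆S : I ⊆ S
  I⊆S = proj₁ (proj₂ S-data)
  S∈H = proj₁ (proj₂ (proj₂ S-data))
  ∣S∣≡s = proj₂ (proj₂ (proj₂ S-data))
  cross : CrossIntersecting 𝒜 ℬ t
  cross B D B∈ D∈ = ≤-trans (proj₂ (meetingIn⁻ (level H s) I t D D∈))
    (≤-trans (∩-monoʳ D (proj₂ (containing⁻ (level H r) I B B∈))) (≤-reflexive (∣∩∣-comm D B)))
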